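{- Let $(a_i)_{i\ge0}$ be positive integers with $a_{2k}=1$ for all $k\geq0$ (the $a_{2k+1}$ arbitrary positive integers). Let $\ell$ be the irrational number with simple continued fraction $[a_0;a_1,a_2,\dots]$ and set $\theta=e^{2/\ell}$. Then $\mathcal A_\theta=\emptyset$. In particular, for every positive integer $c$, if $\theta=e^{ -c+\sqrt{c(c+4)}}$ then $\mathcal A_\theta=\emptyset$.
   Context: $\lfloor x\rfloor$ is the floor of $x$; $\log$ is the natural logarithm. For real $\theta>1$ and positive integer $n$, $M'_\theta(n)=\left\lfloor 1/(\theta^{1/n}-1)\right\rfloor$, and $\mathcal A_\theta=\{n\in\mathbb N: M'_\theta(n)\neq \lfloor n/\log\theta-1/2\rfloor\}$, where $\mathbb N$ is the set of positive integers. $[a_0;a_1,a_2,\dots]$ denotes an infinite simple continued fraction. -}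

module Defs where

open import Algebra.Apartness.Bundles using (HeytingField)
import Algebra.Apartness.Properties.HeytingCommutativeRing as HCRProperties
open import Algebra.Bundles using (CommutativeRing; Semiring)
import Algebra.Definitions.RawMonoid as RawMonoidDefinitions
import Algebra.Definitions.RawSemiring as RawSemiringDefinitions
import Algebra.Properties.Ring as RingProperties
open import Data.Empty using (⊥-elim)
open import Data.Integer.Base using (ℤ; +_; -[1+_])
open import Data.Nat.Base as ℕ using (ℕ; zero; suc; s≤s; _!)
import Data.Nat.Properties as ℕ
open import Data.Product.Base using (∃₂; Σ-syntax; ∃-syntax; _×_; _,_; proj₁; proj₂)
open import Data.Sum.Base using (_⊎_; inj₁; inj₂)
open import Function.Base using (_∘_)
open import Level using (Level; _⊔_) renaming (suc to lsuc)
open import Relation.Binary.Core using (Rel)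
open import Relation.Binary.PropositionalEquality.Core using (_≢_)
open import Relation.Binary.Structures using (IsStrictPartialOrder)
open import Relation.Nullary.Negation using (¬_)
open import Relation.Unary using (Pred)

-- The real numbers, axiomatised as a Cauchy-complete Archimedean ordered
-- field.  Apartness is "strictly less or strictly greater", so x ≤ y is the
-- negation of y < x.  Classically these axioms determine ℝ up to isomorphism.

record RealField c ℓ₁ ℓ₂ : Set (lsuc (c ⊔ ℓ₁ ⊔ ℓ₂)) where
  field
    heytingField : HeytingField c ℓ₁ ℓ₂

  open HeytingField heytingField public hiding (zero)

  commutativeRing : CommutativeRing c ℓ₁
  commutativeRing = record { isCommutativeRing = isCommutativeRing }

  open RawMonoidDefinitions
    (CommutativeRing.+-rawMonoid commutativeRing) public
    using () renaming (_×_ to _·_)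
  open RawSemiringDefinitions
    (Semiring.rawSemiring (CommutativeRing.semiring commutativeRing)) public
    using (_^_)

  infix 4 _<_ _≤_ _⟶_ _≈[_]_

  field
    _<_                  : Rel Carrier ℓ₂
    isStrictPartialOrder : IsStrictPartialOrder _≈_ _<_
    #⇒<⊎>                : ∀ {x y} → x # y → x < y ⊎ y < x
    <⇒#                  : ∀ {x y} → x < y → x # y
    +-monoˡ-<            : ∀ {x y} z → x < y → x + z < y + z
    *-pos                : ∀ {x y} → 0# < x → 0# < y → 0# < x * y

  _≤_ : Rel Carrier ℓ₂
  x ≤ y = ¬ (y < x)

  fromℕ : ℕ → Carrier
  fromℕ n = n · 1#

  _≈[_]_ : Carrier → Carrier → Carrier → Set ℓ₂
  x ≈[ ε ] y = x < y + ε × y < x + ε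

  _⟶_ : (ℕ → Carrier) → Carrier → Set (c ⊔ ℓ₂)
  s ⟶ x = ∀ ε → 0# < ε → ∃[ N ] ∀ n → N ℕ.≤ n → s n ≈[ ε ] x

  Cauchy : (ℕ → Carrier) → Set (c ⊔ ℓ₂)
  Cauchy s = ∀ ε → 0# < ε →
    ∃[ N ] ∀ m n → N ℕ.≤ m → N ℕ.≤ n → s m ≈[ ε ] s n

  field
    archimedean : ∀ x → ∃[ n ] x < fromℕ n
    complete    : ∀ s → Cauchy s → ∃[ x ] s ⟶ x

  fromℤ : ℤ → Carrier
  fromℤ (+ n)    = fromℕ n
  fromℤ -[1+ n ] = - fromℕ (suc n)

module RealNotions {c ℓ₁ ℓ₂ : Level} (ℝ : RealField c ℓ₁ ℓ₂) where

  open RealField ℝ public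

  private
    module O = IsStrictPartialOrder isStrictPartialOrder
    open RingProperties (CommutativeRing.ring commutativeRing)
      using (-‿distribʳ-*; -‿involutive)
    open HCRProperties (HeytingField.heytingCommutativeRing heytingField)
      using (1#0; x-0≈x; invertibleˡ⇒#)

    neg-pos : ∀ {x} → x < 0# → 0# < - x
    neg-pos {x} x<0 =
      O.<-respˡ-≈ (-‿inverseʳ x) (O.<-respʳ-≈ (+-identityˡ (- x))
        (+-monoˡ-< (- x) x<0))

    ¬0<-1 : ¬ (0# < - 1#)
    ¬0<-1 0<-1 = O.asym 0<-1 (O.<-respˡ-≈ (+-identityˡ (- 1#))
      (O.<-respʳ-≈ (-‿inverseʳ 1#) (+-monoˡ-< (- 1#) 0<1′)))
      where
      0<1′ : 0# < 1#
      0<1′ = O.<-respʳ-≈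
        (trans (sym (-‿distribʳ-* (- 1#) 1#))
          (trans (-‿cong (*-identityʳ (- 1#))) (-‿involutive 1#)))
        (*-pos 0<-1 0<-1)

  0<1 : 0# < 1#
  0<1 with #⇒<⊎> 1#0
  ... | inj₁ 1<0 = ⊥-elim (¬0<-1 (neg-pos 1<0))
  ... | inj₂ 0<1 = 0<1

  +-pos : ∀ {x y} → 0# < x → 0# < y → 0# < x + y
  +-pos {x} {y} 0<x 0<y =
    O.trans 0<y (O.<-respˡ-≈ (+-identityˡ y) (+-monoˡ-< y 0<x))

  fromℕ-pos : ∀ {n} → 0 ℕ.< n → 0# < fromℕ n
  fromℕ-pos {suc zero}    _ = O.<-respʳ-≈ (sym (+-identityʳ 1#)) 0<1
  fromℕ-pos {suc (suc n)} _ = +-pos 0<1 (fromℕ-pos {suc n} (s≤s ℕ.z≤n))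

  inv : ∀ x → 0# < x → Carrier
  inv x 0<x = proj₁ (#⇒invertible (#-sym (<⇒# 0<x)))

  inv-inverseˡ : ∀ x (0<x : 0# < x) → inv x 0<x * x ≈ 1#
  inv-inverseˡ x 0<x =
    trans (*-congˡ (sym (x-0≈x x)))
      (proj₁ (proj₂ (#⇒invertible (#-sym (<⇒# 0<x)))))

  inv-pos : ∀ x (0<x : 0# < x) → 0# < inv x 0<x
  inv-pos x 0<x with #⇒<⊎> (invertibleˡ⇒# {inv x 0<x} {0#} (x ,
    trans (*-congˡ (x-0≈x (inv x 0<x)))
      (trans (*-comm x (inv x 0<x)) (inv-inverseˡ x 0<x))))
  ... | inj₂ 0<inv = 0<inv
  ... | inj₁ inv<0 = ⊥-elim (¬0<-1 (O.<-respʳ-≈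
    (trans (sym (-‿distribʳ-* x (inv x 0<x)))
      (-‿cong (trans (*-comm x (inv x 0<x)) (inv-inverseˡ x 0<x))))
    (*-pos 0<x (neg-pos inv<0))))

  infixl 7 _/_[_]

  _/_[_] : ∀ (x y : Carrier) → 0# < y → Carrier
  x / y [ 0<y ] = x * inv y 0<y

  ½ : Carrier
  ½ = 1# / fromℕ 2 [ fromℕ-pos {2} (s≤s ℕ.z≤n) ]

  -- exp, log, nth root and floor are given as functional relations, since the
  -- floor is not constructively computable.  "y = log x" is IsExp y x.

  -- The first n terms of the exponential series.
  expSum : Carrier → ℕ → Carrier
  expSum x zero    = 0#
  expSum x (suc n) = expSum x n + x ^ n / fromℕ (n !) [ fromℕ-pos (ℕ.1≤n! n) ]

  IsExp : Carrier → Carrier → Set (c ⊔ ℓ₂)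
  IsExp x y = expSum x ⟶ y

  IsRoot : ℕ → Carrier → Carrier → Set (ℓ₁ ⊔ ℓ₂)
  IsRoot n x r = 0# < r × r ^ n ≈ x

  IsSqrt : Carrier → Carrier → Set (ℓ₁ ⊔ ℓ₂)
  IsSqrt x r = 0# ≤ r × r * r ≈ x

  IsFloor : Carrier → ℤ → Set ℓ₂
  IsFloor x m = fromℤ m ≤ x × x < fromℤ m + 1#

  -- The finite continued fraction [a₀; a₁, …, aₙ].
  finiteCF : (a : ℕ → ℕ) → (∀ i → 0 ℕ.< a i) → ℕ → Σ[ x ∈ Carrier ] 0# < x
  finiteCF a a>0 zero    = fromℕ (a 0) , fromℕ-pos (a>0 0)
  finiteCF a a>0 (suc n) with finiteCF (a ∘ suc) (a>0 ∘ suc) n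
  ... | x , 0<x =
    fromℕ (a 0) + 1# / x [ 0<x ] ,
    +-pos (fromℕ-pos (a>0 0)) (*-pos 0<1 (inv-pos x 0<x))

  IsCF : (a : ℕ → ℕ) → (∀ i → 0 ℕ.< a i) → Carrier → Set (c ⊔ ℓ₂)
  IsCF a a>0 x = (proj₁ ∘ finiteCF a a>0) ⟶ x

  -- m = ⌊ 1 / (θ^{1/n} - 1) ⌋
  IsM′ : Carrier → ℕ → ℤ → Set (c ⊔ ℓ₁ ⊔ ℓ₂)
  IsM′ θ n m =
    ∃[ r ] Σ[ 0<r-1 ∈ 0# < r - 1# ]
      IsRoot n θ r × IsFloor (1# / (r - 1#) [ 0<r-1 ]) m

  -- m = ⌊ n / log θ - 1/2 ⌋
  IsApprox : Carrier → ℕ → ℤ → Set (c ⊔ ℓ₂)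
  IsApprox θ n m =
    ∃[ l ] Σ[ 0<l ∈ 0# < l ]
      IsExp l θ × IsFloor (fromℕ n / l [ 0<l ] - ½) m

  -- "The two floors differ."  Integer equality is decidable and floors exist up
  -- to double negation, so ¬ 𝒜 θ n is equivalent to the double negation of
  -- "some m is the value of both floors".
  𝒜 : Carrier → Pred ℕ (c ⊔ ℓ₁ ⊔ ℓ₂)
  𝒜 θ n = 0 ℕ.< n × ∃₂ λ m m′ → IsM′ θ n m × IsApprox θ n m′ × m ≢ m′

{-# OPTIONS --safe #-}
module Submission where

-- The number 1/3 comes from the classical formula `q (p − q ℓ) = 1 / (α + q⁻ / q)` for a convergent
-- `p / q` above `ℓ`, with `q⁻` the preceding denominator: the complete quotient `α` begins with a
-- partial quotient 1, so `α < 2`, and `q⁻ ≤ q`. The descent proves the same bound for all fractions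
-- above `ℓ`, without a theory of best approximation. Fractions below `ℓ` admit no such bound, since
-- the other partial quotients are arbitrary; so the one-sided estimate `1/x − 1/2 ≤ w` is
-- essential. Only `log θ` comes with an exponential, and the real number eˣ is never formed. The
-- root `r` is compared with partial sums at `x` by raising both to the n-th power, which calls for
-- finite, two-sided versions of the addition law for exp.

-- Put x = log θ / n = 2 / (n ℓ) and w = 1 / (eˣ − 1).  Two Padé-type bounds on
-- eˣ give 1/x − 1/2 ≤ w < 1/x − 1/2 + x/12, where 1/x − 1/2 = n ℓ / 2 − 1/2.  If
-- the floors differ, an integer m lies in this gap, and the odd number
-- p = 2 m + 1 satisfies 0 < p − n ℓ < 1 / (3 n ℓ).  But ℓ ≥ 1, and because every
-- second partial quotient of ℓ is 1, upper approximations obey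
-- q (p − q ℓ) ≥ 1/3 for all q ≥ 1; this is proved by descent along the even
-- convergents, which tend to ℓ.

open import Defs
open import Algebra.Bundles using (CommutativeRing)
import Algebra.Properties.AbelianGroup as AbelianGroupProperties
import Algebra.Properties.Ring as RingProperties
import Algebra.Properties.Semiring.Exp as Exp
import Algebra.Properties.Semiring.Mult as Mult
import Algebra.Solver.Ring as RingSolver
open import Algebra.Solver.Ring.AlmostCommutativeRing
  using (fromCommutativeRing; _-Raw-AlmostCommutative⟶_)
open import Data.Empty using (⊥; ⊥-elim)
open import Data.Integer.Base as ℤ using (ℤ; +_; -[1+_])
import Data.Integer.Properties as ℤ
open import Data.Maybe.Base using (Maybe)
import Data.Maybe.Base as Maybe
open import Data.Nat.Base as ℕ using (ℕ; zero; suc; _!)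
import Data.Nat.Properties as ℕ
open import Data.Nat.Tactic.RingSolver using (solve-∀)
open import Data.Product.Base using (∃-syntax; _×_; _,_; proj₁; proj₂)
open import Data.Sign.Base as Sign using ()
open import Data.Sum.Base using (_⊎_; inj₁; inj₂)
open import Function.Base using (_∘_)
open import Relation.Binary.Consequences using (dec⇒weaklyDec)
open import Relation.Binary.Definitions using (Tri; tri<; tri≈; tri>)
open import Relation.Binary.PropositionalEquality as ≡ using (_≡_)
open import Relation.Binary.Structures using (IsStrictPartialOrder)
open import Relation.Nullary.Negation using (¬_)
open import Relation.Unary using (Empty)

-- Fractions above the even convergents, in natural numbers

module EvenConvergents where

  open import Data.Nat.Base using (_+_; _*_; _≤_; _<_; s≤s; z≤n)
  open import Data.Nat.Properties using (module ≤-Reasoning)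
  open ≤-Reasoning

  -- numer b k / denom b k = [1; b₀, 1, b₁, …, bₖ₋₁, 1].
  mutual
    numer : (ℕ → ℕ) → ℕ → ℕ
    numer b zero    = 1
    numer b (suc k) = denom b (suc k) + numer (b ∘ suc) k

    denom : (ℕ → ℕ) → ℕ → ℕ
    denom b zero    = 1
    denom b (suc k) = b 0 * numer (b ∘ suc) k + denom (b ∘ suc) k

  Positive : (ℕ → ℕ) → Set
  Positive b = ∀ i → 0 < b i

  denom≤numer : ∀ b k → denom b k ≤ numer b k
  denom≤numer b zero    = ℕ.≤-refl
  denom≤numer b (suc k) = ℕ.m≤m+n (denom b (suc k)) (numer (b ∘ suc) k)

  -- Besides positivity, this gives the growth that makes the periodic convergents converge.
  n<denom : ∀ {b} → Positive b → ∀ k → k < denom b k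
  n<denom b>0 zero = s≤s z≤n
  n<denom {b} b>0 (suc k) = ℕ.+-mono-≤
    (ℕ.*-mono-≤ (b>0 0) (ℕ.≤-trans (ℕ.≤-trans (s≤s z≤n) (n<denom (b>0 ∘ suc) k)) (denom≤numer (b ∘ suc) k)))
    (n<denom (b>0 ∘ suc) k)

  0<denom : ∀ {b} → Positive b → ∀ k → 0 < denom b k
  0<denom b>0 k = ℕ.≤-trans (s≤s z≤n) (n<denom b>0 k)

  -- A leading partial quotient 1 leaves a remainder of at most 1. This 2, plus one, is the 3 in
  -- `gap`.
  numer≤2*denom : ∀ {b} → Positive b → ∀ k → numer b k ≤ 2 * denom b k
  numer≤2*denom b>0 zero = s≤s z≤n
  numer≤2*denom {b} b>0 (suc k) = ℕ.+-monoʳ-≤ (denom b (suc k)) (begin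
    P                 ≡⟨ ℕ.*-identityˡ P ⟨
    1 * P             ≤⟨ ℕ.*-monoˡ-≤ P (b>0 0) ⟩
    b 0 * P           ≤⟨ ℕ.m≤m+n (b 0 * P) (denom (b ∘ suc) k) ⟩
    denom b (suc k)   ≤⟨ ℕ.m≤m+n (denom b (suc k)) 0 ⟩
    denom b (suc k) + 0 ∎)
    where P = numer (b ∘ suc) k

  -- The determinant D = p Q − q P of a fraction p / q above P / Q bounds
  -- q² (p / q − P / Q) = q D / Q from below by 1/3.  Writing p = q + r and
  -- q = a r ± s, the fraction r / s is compared with the tail convergent.
  gap : ∀ {b} → Positive b → ∀ k p q D → 0 < q → 0 < D →
    p * denom b k ≡ q * numer b k + D → denom b k ≤ 3 * (q * D)
  gap b>0 zero p q D 0<q 0<D _ = ℕ.≤-trans (ℕ.*-mono-≤ 0<q 0<D) (ℕ.m≤m+n (q * D) _)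
  gap {b} b>0 (suc k) p q D 0<q 0<D pQ≡qP+D = by-quotient (ℕ.≤-total q (a * r))
    where
    a = b 0
    P′ = numer (b ∘ suc) k
    Q′ = denom (b ∘ suc) k
    Q = a * P′ + Q′
    0<Q′ = 0<denom (b>0 ∘ suc) k
    r = p ℕ.∸ q
    q<p : q < p
    q<p = ℕ.*-cancelʳ-< Q q p (begin-strict
      q * Q                <⟨ ℕ.m<m+n (q * Q) (ℕ.≤-trans 0<D (ℕ.m≤n+m D (q * P′))) ⟩
      q * Q + (q * P′ + D) ≡⟨ ℕ.+-assoc (q * Q) (q * P′) D ⟨
      q * Q + q * P′ + D   ≡⟨ ≡.cong (_+ D) (ℕ.*-distribˡ-+ q Q P′) ⟨
      q * (Q + P′) + D     ≡⟨ pQ≡qP+D ⟨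
      p * Q                ∎)
    0<r : 0 < r
    0<r = ℕ.m<n⇒0<n∸m q<p
    p≡q+r : p ≡ q + r
    p≡q+r = ≡.sym (ℕ.m+[n∸m]≡n (ℕ.<⇒≤ q<p))
    rQ≡qP′+D : r * Q ≡ q * P′ + D
    rQ≡qP′+D = ℕ.+-cancelˡ-≡ (q * Q) (r * Q) (q * P′ + D) (begin-equality
      q * Q + r * Q        ≡⟨ ℕ.*-distribʳ-+ Q q r ⟨
      (q + r) * Q          ≡⟨ ≡.cong (_* Q) p≡q+r ⟨
      p * Q                ≡⟨ pQ≡qP+D ⟩
      q * (Q + P′) + D     ≡⟨ ≡.cong (_+ D) (ℕ.*-distribˡ-+ q Q P′) ⟩
      q * Q + q * P′ + D   ≡⟨ ℕ.+-assoc (q * Q) (q * P′) D ⟩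
      q * Q + (q * P′ + D) ∎)

    expand : ∀ r a P′ Q′ → r * (a * P′ + Q′) ≡ a * r * P′ + r * Q′
    expand = solve-∀

    below : ∀ t → a * r ≡ q + t → Q ≤ 3 * (q * D)
    below t ar≡q+t = begin
      a * P′ + Q′
        ≤⟨ ℕ.+-mono-≤ (ℕ.*-monoˡ-≤ P′ a≤q+t) (ℕ.≤-trans (ℕ.≤-reflexive (≡.sym (ℕ.*-identityˡ Q′))) (ℕ.*-monoˡ-≤ Q′ 0<q)) ⟩
      (q + t) * P′ + q * Q′
        ≡⟨ ≡.cong (_+ q * Q′) (ℕ.*-distribʳ-+ P′ q t) ⟩
      q * P′ + t * P′ + q * Q′
        ≤⟨ ℕ.+-monoˡ-≤ (q * Q′) (ℕ.+-mono-≤ (ℕ.*-monoʳ-≤ q (numer≤2*denom (b>0 ∘ suc) k))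
             (ℕ.≤-trans (ℕ.≤-reflexive (≡.sym (ℕ.*-identityˡ (t * P′)))) (ℕ.*-monoˡ-≤ (t * P′) 0<q))) ⟩
      q * (2 * Q′) + q * (t * P′) + q * Q′
        ≤⟨ ℕ.m≤m+n _ (2 * (q * (t * P′))) ⟩
      q * (2 * Q′) + q * (t * P′) + q * Q′ + 2 * (q * (t * P′))
        ≡⟨ collect q t P′ Q′ ⟩
      3 * (q * (1 * Q′ + t * P′))
        ≤⟨ ℕ.*-monoʳ-≤ 3 (ℕ.*-monoʳ-≤ q (ℕ.+-monoˡ-≤ (t * P′) (ℕ.*-monoˡ-≤ Q′ 0<r))) ⟩
      3 * (q * (r * Q′ + t * P′))
        ≡⟨ ≡.cong (λ d → 3 * (q * d)) D≡ ⟨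
      3 * (q * D) ∎
      where
      a≤q+t : a ≤ q + t
      a≤q+t = begin
        a     ≡⟨ ℕ.*-identityʳ a ⟨
        a * 1 ≤⟨ ℕ.*-monoʳ-≤ a 0<r ⟩
        a * r ≡⟨ ar≡q+t ⟩
        q + t ∎
      collect : ∀ q t P′ Q′ → q * (2 * Q′) + q * (t * P′) + q * Q′ + 2 * (q * (t * P′)) ≡
        3 * (q * (1 * Q′ + t * P′))
      collect = solve-∀
      regroup : ∀ q t P′ rQ′ → (q + t) * P′ + rQ′ ≡ q * P′ + (rQ′ + t * P′)
      regroup = solve-∀
      D≡ : D ≡ r * Q′ + t * P′
      D≡ = ℕ.+-cancelˡ-≡ (q * P′) D (r * Q′ + t * P′) (begin-equality
        q * P′ + D                 ≡⟨ rQ≡qP′+D ⟨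
        r * Q                      ≡⟨ expand r a P′ Q′ ⟩
        a * r * P′ + r * Q′        ≡⟨ ≡.cong (λ z → z * P′ + r * Q′) ar≡q+t ⟩
        (q + t) * P′ + r * Q′      ≡⟨ regroup q t P′ (r * Q′) ⟩
        q * P′ + (r * Q′ + t * P′) ∎)

    -- Here `r / s` lies above `P′ / Q′` with the same determinant `D`, so the induction hypothesis
    -- applies to it.
    above : ∀ s → 0 < s → q ≡ a * r + s → Q ≤ 3 * (q * D)
    above s 0<s q≡ar+s = begin
      a * P′ + Q′                     ≤⟨ ℕ.+-mono-≤ aP′≤ Q′≤3sD ⟩
      a * (3 * (r * D)) + 3 * (s * D) ≡⟨ collect a r s D ⟩
      3 * ((a * r + s) * D)           ≡⟨ ≡.cong (λ z → 3 * (z * D)) q≡ar+s ⟨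
      3 * (q * D)                     ∎
      where
      collect : ∀ a r s D → a * (3 * (r * D)) + 3 * (s * D) ≡ 3 * ((a * r + s) * D)
      collect = solve-∀
      regroup : ∀ ar s P′ D → (ar + s) * P′ + D ≡ ar * P′ + (s * P′ + D)
      regroup = solve-∀
      rQ′≡sP′+D : r * Q′ ≡ s * P′ + D
      rQ′≡sP′+D = ℕ.+-cancelˡ-≡ (a * r * P′) (r * Q′) (s * P′ + D) (begin-equality
        a * r * P′ + r * Q′        ≡⟨ expand r a P′ Q′ ⟨
        r * Q                      ≡⟨ rQ≡qP′+D ⟩
        q * P′ + D                 ≡⟨ ≡.cong (λ z → z * P′ + D) q≡ar+s ⟩
        (a * r + s) * P′ + D       ≡⟨ regroup (a * r) s P′ D ⟩
        a * r * P′ + (s * P′ + D)  ∎)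
      Q′≤3sD : Q′ ≤ 3 * (s * D)
      Q′≤3sD = gap (b>0 ∘ suc) k r s D 0<s 0<D rQ′≡sP′+D
      swap₁ : ∀ s P′ D → P′ * (3 * (s * D)) ≡ 3 * (s * P′ * D)
      swap₁ = solve-∀
      swap₂ : ∀ r Q′ D → 3 * (r * Q′ * D) ≡ 3 * (r * D) * Q′
      swap₂ = solve-∀
      -- As `s P′ ≤ r Q′`, the bound on `Q′` in terms of `s` becomes one on `P′` in terms of `r`.
      -- The two add up along `q = a r + s`.
      P′≤3rD : P′ ≤ 3 * (r * D)
      P′≤3rD = ℕ.*-cancelʳ-≤ P′ (3 * (r * D)) Q′ ⦃ ℕ.>-nonZero 0<Q′ ⦄ (begin
        P′ * Q′            ≤⟨ ℕ.*-monoʳ-≤ P′ Q′≤3sD ⟩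
        P′ * (3 * (s * D)) ≡⟨ swap₁ s P′ D ⟩
        3 * (s * P′ * D)   ≤⟨ ℕ.*-monoʳ-≤ 3 (ℕ.*-monoˡ-≤ D
                                (ℕ.≤-trans (ℕ.m≤m+n (s * P′) D) (ℕ.≤-reflexive (≡.sym rQ′≡sP′+D)))) ⟩
        3 * (r * Q′ * D)   ≡⟨ swap₂ r Q′ D ⟩
        3 * (r * D) * Q′   ∎)
      aP′≤ : a * P′ ≤ a * (3 * (r * D))
      aP′≤ = ℕ.*-monoʳ-≤ a P′≤3rD

    by-quotient : q ≤ a * r ⊎ a * r ≤ q → Q ≤ 3 * (q * D)
    by-quotient (inj₁ q≤ar) = below (a * r ℕ.∸ q) (≡.sym (ℕ.m+[n∸m]≡n q≤ar))
    by-quotient (inj₂ ar≤q) with ℕ.m≤n⇒m<n∨m≡n ar≤q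
    ... | inj₁ ar<q = above (q ℕ.∸ a * r) (ℕ.m<n⇒0<n∸m ar<q) (≡.sym (ℕ.m+[n∸m]≡n ar≤q))
    -- Equality belongs to `below`, because the descent needs a positive `s` as new denominator.
    ... | inj₂ ar≡q = below 0 (≡.trans ar≡q (≡.sym (ℕ.+-identityʳ q)))

module Reals {c ℓ₁ ℓ₂} (ℝ : RealField c ℓ₁ ℓ₂) where

  open RealNotions ℝ
  open IsStrictPartialOrder isStrictPartialOrder
    using (<-respˡ-≈; <-respʳ-≈)
    renaming (trans to <-trans; asym to <-asym; irrefl to <-irrefl)
  open RingProperties (CommutativeRing.ring commutativeRing)
    using (-‿involutive; -‿distribˡ-*; -‿distribʳ-*; -0#≈0#)
  open AbelianGroupProperties (CommutativeRing.+-abelianGroup commutativeRing)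
    using (⁻¹-∙-comm)
  open Mult (CommutativeRing.semiring commutativeRing)
    using (×-homo-+; ×1-homo-*)
  open Exp (CommutativeRing.semiring commutativeRing)
    using (^-congˡ)
  open import Relation.Binary.Reasoning.Setoid
    (CommutativeRing.setoid commutativeRing)

  -- Ordered field arithmetic

  fromℕ-+ : ∀ m n → fromℕ (m ℕ.+ n) ≈ fromℕ m + fromℕ n
  fromℕ-+ = ×-homo-+ 1#

  fromℕ-* : ∀ m n → fromℕ (m ℕ.* n) ≈ fromℕ m * fromℕ n
  fromℕ-* = ×1-homo-*

  fromℤ-⊖ : ∀ m n → fromℤ (m ℤ.⊖ n) ≈ fromℕ m - fromℕ n
  fromℤ-⊖ m zero = sym (trans (+-congˡ -0#≈0#) (+-identityʳ (fromℕ m)))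
  fromℤ-⊖ zero (suc n) = sym (+-identityˡ (- fromℕ (suc n)))
  fromℤ-⊖ (suc m) (suc n) =
    trans (reflexive (≡.cong fromℤ (ℤ.[1+m]⊖[1+n]≡m⊖n m n)))
      (trans (fromℤ-⊖ m n) (sym (begin
        (1# + fromℕ m) - (1# + fromℕ n)
          ≈⟨ +-cong (+-comm 1# (fromℕ m)) (sym (⁻¹-∙-comm 1# (fromℕ n))) ⟩
        (fromℕ m + 1#) + (- 1# - fromℕ n)
          ≈⟨ +-assoc (fromℕ m) 1# (- 1# - fromℕ n) ⟩
        fromℕ m + (1# + (- 1# - fromℕ n))
          ≈⟨ +-congˡ (sym (+-assoc 1# (- 1#) (- fromℕ n))) ⟩
        fromℕ m + ((1# - 1#) - fromℕ n)
          ≈⟨ +-congˡ (trans (+-congʳ (-‿inverseʳ 1#)) (+-identityˡ (- fromℕ n))) ⟩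
        fromℕ m - fromℕ n ∎)))

  fromℤ-+ : ∀ i j → fromℤ (i ℤ.+ j) ≈ fromℤ i + fromℤ j
  fromℤ-+ (+ m) (+ n) = fromℕ-+ m n
  fromℤ-+ (+ m) -[1+ n ] = fromℤ-⊖ m (suc n)
  fromℤ-+ -[1+ m ] (+ n) =
    trans (fromℤ-⊖ n (suc m)) (+-comm (fromℕ n) (- fromℕ (suc m)))
  fromℤ-+ -[1+ m ] -[1+ n ] =
    trans (-‿cong (trans (reflexive (≡.cong fromℕ (≡.sym (ℕ.+-suc (suc m) n))))
      (fromℕ-+ (suc m) (suc n)))) (sym (⁻¹-∙-comm (fromℕ (suc m)) (fromℕ (suc n))))

  fromℤ-neg : ∀ i → fromℤ (ℤ.- i) ≈ - fromℤ i
  fromℤ-neg (+ zero)  = sym -0#≈0#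
  fromℤ-neg (+ suc n) = refl
  fromℤ-neg -[1+ n ]  = sym (-‿involutive (fromℕ (suc n)))

  fromℤ--◃ : ∀ n → fromℤ (Sign.- ℤ.◃ n) ≈ - fromℕ n
  fromℤ--◃ zero    = sym -0#≈0#
  fromℤ--◃ (suc n) = refl

  fromℤ-+◃ : ∀ n → fromℤ (Sign.+ ℤ.◃ n) ≈ fromℕ n
  fromℤ-+◃ zero    = refl
  fromℤ-+◃ (suc n) = refl

  fromℤ-* : ∀ i j → fromℤ (i ℤ.* j) ≈ fromℤ i * fromℤ j
  fromℤ-* (+ m) (+ n) = trans (fromℤ-+◃ (m ℕ.* n)) (fromℕ-* m n)
  fromℤ-* (+ m) -[1+ n ] = trans (fromℤ--◃ (m ℕ.* suc n))
    (trans (-‿cong (fromℕ-* m (suc n))) (-‿distribʳ-* (fromℕ m) (fromℕ (suc n))))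
  fromℤ-* -[1+ m ] (+ n) = trans (fromℤ--◃ (suc m ℕ.* n))
    (trans (-‿cong (fromℕ-* (suc m) n)) (-‿distribˡ-* (fromℕ (suc m)) (fromℕ n)))
  fromℤ-* -[1+ m ] -[1+ n ] = trans (fromℕ-* (suc m) (suc n))
    (trans (sym (-‿involutive _)) (trans (-‿cong (-‿distribʳ-* (fromℕ (suc m)) (fromℕ (suc n))))
      (-‿distribˡ-* (fromℕ (suc m)) (- fromℕ (suc n)))))

  -- Unlike fromℤ, this sends + 1 to 1# on the nose, so that 1# itself is a
  -- constant of the ring solver.
  coefficient : ℤ → Carrier
  coefficient (+ 1) = 1#
  coefficient i     = fromℤ i

  coefficient≈fromℤ : ∀ i → coefficient i ≈ fromℤ i
  coefficient≈fromℤ (+ 0)           = refl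
  coefficient≈fromℤ (+ 1)           = sym (+-identityʳ 1#)
  coefficient≈fromℤ (+ suc (suc n)) = refl
  coefficient≈fromℤ -[1+ n ]        = refl

  coefficient-morphism :
    ℤ.+-*-rawRing -Raw-AlmostCommutative⟶ fromCommutativeRing commutativeRing
  coefficient-morphism = record
    { ⟦_⟧    = coefficient
    ; +-homo = λ i j → trans (coefficient≈fromℤ (i ℤ.+ j)) (trans (fromℤ-+ i j)
        (sym (+-cong (coefficient≈fromℤ i) (coefficient≈fromℤ j))))
    ; *-homo = λ i j → trans (coefficient≈fromℤ (i ℤ.* j)) (trans (fromℤ-* i j)
        (sym (*-cong (coefficient≈fromℤ i) (coefficient≈fromℤ j))))
    ; -‿homo = λ i → trans (coefficient≈fromℤ (ℤ.- i)) (trans (fromℤ-neg i)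
        (sym (-‿cong (coefficient≈fromℤ i))))
    ; 0-homo = refl
    ; 1-homo = refl
    }

  _coefficient≟_ : ∀ i j → Maybe (coefficient i ≈ coefficient j)
  i coefficient≟ j =
    Maybe.map (λ { ≡.refl → refl }) (dec⇒weaklyDec ℤ._≟_ i j)

  open RingSolver ℤ.+-*-rawRing (fromCommutativeRing commutativeRing)
    coefficient-morphism _coefficient≟_
    using (Polynomial; solve; con; _:+_; _:*_; _:-_; :-_; _:^_; _:=_)

  infix 10 #_
  #_ : ∀ {n} → ℕ → Polynomial n
  # k = con (+ k)

  infixl 6 _⊕_

  x<y⇒0<y-x : ∀ {x y} → x < y → 0# < y - x
  x<y⇒0<y-x {x} {y} x<y = <-respˡ-≈ (-‿inverseʳ x) (+-monoˡ-< (- x) x<y)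

  -- The certificate format of most inequalities that follow: a visibly positive difference `e`, and
  -- an identity left to the ring solver.
  <-by : ∀ {x y e} → 0# < e → x + e ≈ y → x < y
  <-by {x} {y} {e} 0<e x+e≈y =
    <-respˡ-≈ (+-identityˡ x) (<-respʳ-≈ (trans (+-comm e x) x+e≈y) (+-monoˡ-< x 0<e))

  x≤y⇒0≤y-x : ∀ {x y} → x ≤ y → 0# ≤ y - x
  x≤y⇒0≤y-x {x} {y} x≤y y-x<0 = x≤y (<-by (x<y⇒0<y-x y-x<0)
    (solve 2 (λ x y → y :+ (# 0 :- (y :- x)) := x) refl x y))

  ≤-by : ∀ {x y e} → 0# ≤ e → x + e ≈ y → x ≤ y
  ≤-by {x} {y} {e} 0≤e x+e≈y y<x = 0≤e (<-by (x<y⇒0<y-x y<x)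
    (trans (+-congˡ (+-congˡ (-‿cong (sym x+e≈y))))
      (solve 2 (λ x e → e :+ (x :- (x :+ e)) := # 0) refl x e)))

  <⇒≤ : ∀ {x y} → x < y → x ≤ y
  <⇒≤ = <-asym

  ≤-refl : ∀ {x} → x ≤ x
  ≤-refl = <-irrefl refl

  ≈⇒≤ : ∀ {x y} → x ≈ y → x ≤ y
  ≈⇒≤ x≈y = <-irrefl (sym x≈y)

  -- The constructive stand-in for trichotomy. With `≤` a negation, mixed transitivity rests on it.
  <-cotrans : ∀ {x y} → x < y → ∀ z → x < z ⊎ z < y
  <-cotrans x<y z with #-cotrans (<⇒# x<y) z
  ... | inj₁ x#z with #⇒<⊎> x#z
  ...   | inj₁ x<z = inj₁ x<z
  ...   | inj₂ z<x = inj₂ (<-trans z<x x<y)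
  <-cotrans x<y z | inj₂ z#y with #⇒<⊎> z#y
  ...   | inj₁ z<y = inj₂ z<y
  ...   | inj₂ y<z = inj₁ (<-trans x<y y<z)

  <-≤-trans : ∀ {x y z} → x < y → y ≤ z → x < z
  <-≤-trans {z = z} x<y y≤z with <-cotrans x<y z
  ... | inj₁ x<z = x<z
  ... | inj₂ z<y = ⊥-elim (y≤z z<y)

  ≤-<-trans : ∀ {x y z} → x ≤ y → y < z → x < z
  ≤-<-trans {x} x≤y y<z with <-cotrans y<z x
  ... | inj₁ y<x = ⊥-elim (x≤y y<x)
  ... | inj₂ x<z = x<z

  ≤-trans : ∀ {x y z} → x ≤ y → y ≤ z → x ≤ z
  ≤-trans x≤y y≤z z<x = y≤z (<-≤-trans z<x x≤y)

  _⊕_ : ∀ {x y} → 0# ≤ x → 0# ≤ y → 0# ≤ x + y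
  _⊕_ {x} {y} 0≤x 0≤y =
    ≤-trans 0≤y (≤-by 0≤x (+-comm y x))

  +-pos-nonneg : ∀ {x y} → 0# < x → 0# ≤ y → 0# < x + y
  +-pos-nonneg {x} {y} 0<x 0≤y = ≤-<-trans 0≤y (<-by 0<x (+-comm y x))

  *-cancelˡ-< : ∀ {z x y} → 0# < z → z * x < z * y → x < y
  *-cancelˡ-< {z} {x} {y} 0<z zx<zy =
    <-by (*-pos (inv-pos z 0<z) (x<y⇒0<y-x zx<zy)) (trans
      (solve 4 (λ x y z w → x :+ w :* (z :* y :- z :* x) := y :* (w :* z) :+ x :* (# 1 :- (w :* z)))
        refl x y z (inv z 0<z))
      (trans (+-cong (*-congˡ (inv-inverseˡ z 0<z)) (*-congˡ (+-congˡ (-‿cong (inv-inverseˡ z 0<z)))))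
        (solve 2 (λ x y → y :* # 1 :+ x :* (# 1 :- # 1) := y) refl x y)))

  *-monoˡ-< : ∀ {z x y} → 0# < z → x < y → z * x < z * y
  *-monoˡ-< {z} {x} {y} 0<z x<y = <-by (*-pos 0<z (x<y⇒0<y-x x<y))
    (solve 3 (λ x y z → z :* x :+ z :* (y :- x) := z :* y) refl x y z)

  *-cancelˡ-≤ : ∀ {z x y} → 0# < z → z * x ≤ z * y → x ≤ y
  *-cancelˡ-≤ 0<z zx≤zy y<x = zx≤zy (*-monoˡ-< 0<z y<x)

  *-pos-nonneg : ∀ {x y} → 0# < x → 0# ≤ y → 0# ≤ x * y
  *-pos-nonneg {x} {y} 0<x 0≤y xy<0 =
    0≤y (*-cancelˡ-< 0<x (<-respʳ-≈ (sym (zeroʳ x)) xy<0))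

  -- Whether `x` is zero or positive cannot be decided. But a negative product refutes `0 < x`, so
  -- tightness forces `x ≈ 0`, and then the product vanishes.
  *-nonneg : ∀ {x y} → 0# ≤ x → 0# ≤ y → 0# ≤ x * y
  *-nonneg {x} {y} 0≤x 0≤y xy<0 =
    <-irrefl (trans (*-congʳ x≈0) (zeroˡ y)) xy<0
    where
    ¬x#0 : ¬ (x # 0#)
    ¬x#0 x#0 with #⇒<⊎> x#0
    ... | inj₁ x<0 = 0≤x x<0
    ... | inj₂ 0<x = *-pos-nonneg 0<x 0≤y xy<0
    x≈0 : x ≈ 0#
    x≈0 = proj₁ (tight x 0#) ¬x#0

  -- An equation contributes a multiple of its vanishing difference to a
  -- positivity certificate.
  ≈⇒0≤ : ∀ k {x y} → x ≈ y → 0# ≤ k * (y - x)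
  ≈⇒0≤ k {x} {y} x≈y = ≈⇒≤ (sym (trans (*-congˡ (+-congˡ (-‿cong x≈y)))
    (solve 2 (λ k y → k :* (y :- y) := # 0) refl k y)))

  *-monoˡ-≤ : ∀ {z x y} → 0# ≤ z → x ≤ y → z * x ≤ z * y
  *-monoˡ-≤ {z} {x} {y} 0≤z x≤y = ≤-by (*-nonneg 0≤z (x≤y⇒0≤y-x x≤y))
    (solve 3 (λ x y z → z :* x :+ z :* (y :- x) := z :* y) refl x y z)

  *-mono-≤ : ∀ {w x y z} → 0# ≤ w → 0# ≤ y → w ≤ x → y ≤ z → w * y ≤ x * z
  *-mono-≤ {w} {x} {y} {z} 0≤w 0≤y w≤x y≤z =
    ≤-by (*-nonneg 0≤w (x≤y⇒0≤y-x y≤z)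
        ⊕ *-nonneg (≤-trans 0≤y y≤z) (x≤y⇒0≤y-x w≤x))
      (solve 4 (λ w x y z → w :* y :+ (w :* (z :- y) :+ z :* (x :- w)) := x :* z) refl w x y z)

  +-mono-≤ : ∀ {w x y z} → w ≤ x → y ≤ z → w + y ≤ x + z
  +-mono-≤ {w} {x} {y} {z} w≤x y≤z = ≤-by (x≤y⇒0≤y-x w≤x ⊕ x≤y⇒0≤y-x y≤z)
    (solve 4 (λ w x y z → w :+ y :+ ((x :- w) :+ (z :- y)) := x :+ z) refl w x y z)

  0≤1 : 0# ≤ 1#
  0≤1 = <⇒≤ 0<1

  fromℕ-nonneg : ∀ n → 0# ≤ fromℕ n
  fromℕ-nonneg zero    = ≤-refl
  fromℕ-nonneg (suc n) = 0≤1 ⊕ fromℕ-nonneg n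

  fromℕ-mono-≤ : ∀ {m n} → m ℕ.≤ n → fromℕ m ≤ fromℕ n
  fromℕ-mono-≤ {m} {n} m≤n = ≤-by (fromℕ-nonneg (n ℕ.∸ m))
    (trans (sym (fromℕ-+ m (n ℕ.∸ m))) (reflexive (≡.cong fromℕ (ℕ.m+[n∸m]≡n m≤n))))

  fromℕ-cancel-< : ∀ {m n} → fromℕ m < fromℕ n → m ℕ.< n
  fromℕ-cancel-< m<n = ℕ.≰⇒> (λ n≤m → fromℕ-mono-≤ n≤m m<n)

  ^-nonneg : ∀ {x} → 0# ≤ x → ∀ n → 0# ≤ x ^ n
  ^-nonneg 0≤x zero    = 0≤1
  ^-nonneg 0≤x (suc n) = *-nonneg 0≤x (^-nonneg 0≤x n)

  ^-pos : ∀ {x} → 0# < x → ∀ n → 0# < x ^ n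
  ^-pos 0<x zero    = 0<1
  ^-pos 0<x (suc n) = *-pos 0<x (^-pos 0<x n)

  ^-mono-≤ : ∀ {x y} → 0# ≤ x → x ≤ y → ∀ n → x ^ n ≤ y ^ n
  ^-mono-≤ 0≤x x≤y zero    = ≤-refl
  ^-mono-≤ 0≤x x≤y (suc n) = *-mono-≤ 0≤x (^-nonneg 0≤x n) x≤y (^-mono-≤ 0≤x x≤y n)

  ^-monoˡ-< : ∀ {x y} → 0# ≤ x → x < y → ∀ n → x ^ suc n < y ^ suc n
  ^-monoˡ-< {x} {y} 0≤x x<y n = ≤-<-trans
    (*-monoˡ-≤ 0≤x (^-mono-≤ 0≤x (<⇒≤ x<y) n))
    (<-respˡ-≈ (*-comm (y ^ n) x) (<-respʳ-≈ (*-comm (y ^ n) y)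
      (*-monoˡ-< (^-pos (≤-<-trans 0≤x x<y) n) x<y)))

  ^-cancel-≤ : ∀ {x y n} → 0 ℕ.< n → 0# ≤ y → x ^ n ≤ y ^ n → x ≤ y
  ^-cancel-≤ {n = suc n} _ 0≤y xⁿ≤yⁿ y<x = xⁿ≤yⁿ (^-monoˡ-< 0≤y y<x n)

  *-*-inv : ∀ x {y} (0<y : 0# < y) → y * (x / y [ 0<y ]) ≈ x
  *-*-inv x {y} 0<y = trans
    (solve 3 (λ x y i → y :* (x :* i) := x :* (i :* y)) refl x y (inv y 0<y))
    (trans (*-congˡ (inv-inverseˡ y 0<y)) (*-identityʳ x))

  *≤⇒≤/ : ∀ {x y z} (0<z : 0# < z) → z * x ≤ y → x ≤ y / z [ 0<z ]
  *≤⇒≤/ {y = y} 0<z zx≤y = *-cancelˡ-≤ 0<z (≤-trans zx≤y (≈⇒≤ (sym (*-*-inv y 0<z))))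

  ≤/⇒*≤ : ∀ {x y z} (0<z : 0# < z) → x ≤ y / z [ 0<z ] → z * x ≤ y
  ≤/⇒*≤ {y = y} 0<z x≤y/z = ≤-trans (*-monoˡ-≤ (<⇒≤ 0<z) x≤y/z) (≈⇒≤ (*-*-inv y 0<z))

  </⇒*< : ∀ {x y z} (0<z : 0# < z) → x < y / z [ 0<z ] → z * x < y
  </⇒*< {y = y} 0<z x<y/z = <-respʳ-≈ (*-*-inv y 0<z) (*-monoˡ-< 0<z x<y/z)

  *<⇒</ : ∀ {x y z} (0<z : 0# < z) → z * x < y → x < y / z [ 0<z ]
  *<⇒</ {y = y} 0<z zx<y = *-cancelˡ-< 0<z (<-respʳ-≈ (sym (*-*-inv y 0<z)) zx<y)

  ⟶-≤ : ∀ {s x B} → s ⟶ x → ∀ M → (∀ n → M ℕ.≤ n → s n ≤ B) → x ≤ B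
  ⟶-≤ {s} {x} {B} s⟶x M s≤B B<x with s⟶x (x - B) (x<y⇒0<y-x B<x)
  ... | N , near = s≤B (M ℕ.⊔ N) (ℕ.m≤m⊔n M N) (<-by
    (x<y⇒0<y-x (proj₂ (near (M ℕ.⊔ N) (ℕ.m≤n⊔m M N))))
    (solve 3 (λ B s x → B :+ (s :+ (x :- B) :- x) := s) refl B (s (M ℕ.⊔ N)) x))

  ⟶-≥ : ∀ {s x B} → s ⟶ x → ∀ M → (∀ n → M ℕ.≤ n → B ≤ s n) → B ≤ x
  ⟶-≥ {s} {x} {B} s⟶x M B≤s x<B with s⟶x (B - x) (x<y⇒0<y-x x<B)
  ... | N , near = B≤s (M ℕ.⊔ N) (ℕ.m≤m⊔n M N) (<-by
    (x<y⇒0<y-x (proj₁ (near (M ℕ.⊔ N) (ℕ.m≤n⊔m M N))))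
    (solve 3 (λ B s x → s :+ (x :+ (B :- x) :- s) := B) refl B (s (M ℕ.⊔ N)) x))

  ⟶-eventually-< : ∀ {s x y} → s ⟶ x → x < y → ∃[ N ] ∀ n → N ℕ.≤ n → s n < y
  ⟶-eventually-< {s} {x} {y} s⟶x x<y with s⟶x (y - x) (x<y⇒0<y-x x<y)
  ... | N , near = N , λ n N≤n → <-respʳ-≈
    (solve 2 (λ x y → x :+ (y :- x) := y) refl x y) (proj₁ (near n N≤n))

  -- Cauchy products and the exponential series

  Sequence : Set c
  Sequence = ℕ → Carrier

  tail : Sequence → Sequence
  tail f i = f (suc i)

  Σ[<_] : ℕ → Sequence → Carrier
  Σ[< zero ]  f = 0#
  Σ[< suc n ] f = Σ[< n ] f + f n

  -- The Cauchy product, by recursion on the left factor, so that no index is ever subtracted.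
  conv : Sequence → Sequence → Sequence
  conv f g zero    = f 0 * g 0
  conv f g (suc k) = f 0 * g (suc k) + conv (tail f) g k

  Nonneg : Sequence → Set ℓ₂
  Nonneg f = ∀ i → 0# ≤ f i

  -- With f = Σ aᵢ tⁱ as a power series, index f = t f′.
  index : Sequence → Sequence
  index f i = fromℕ i * f i

  Σ-cong : ∀ {f g} → (∀ i → f i ≈ g i) → ∀ n → Σ[< n ] f ≈ Σ[< n ] g
  Σ-cong f≈g zero    = refl
  Σ-cong f≈g (suc n) = +-cong (Σ-cong f≈g n) (f≈g n)

  Σ-nonneg : ∀ {f} → Nonneg f → ∀ n → 0# ≤ Σ[< n ] f
  Σ-nonneg 0≤f zero    = ≤-refl
  Σ-nonneg 0≤f (suc n) = Σ-nonneg 0≤f n ⊕ 0≤f n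

  Σ-suc : ∀ f n → Σ[< suc n ] f ≈ f 0 + Σ[< n ] (tail f)
  Σ-suc f zero    = +-comm 0# (f 0)
  Σ-suc f (suc n) = trans (+-congʳ (Σ-suc f n)) (+-assoc (f 0) (Σ[< n ] (tail f)) (f (suc n)))

  Σ-monoˡ-≤ : ∀ {f} → Nonneg f → ∀ {m n} → m ℕ.≤ n → Σ[< m ] f ≤ Σ[< n ] f
  Σ-monoˡ-≤ {f} 0≤f m≤n = go (ℕ.≤⇒≤′ m≤n)
    where
    go : ∀ {m n} → m ℕ.≤′ n → Σ[< m ] f ≤ Σ[< n ] f
    go ℕ.≤′-refl               = ≤-refl
    go {n = suc n} (ℕ.≤′-step m≤n) = ≤-trans (go m≤n) (≤-by (0≤f n) refl)

  conv-cong : ∀ {f f′ g g′} → (∀ i → f i ≈ f′ i) → (∀ i → g i ≈ g′ i) →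
    ∀ k → conv f g k ≈ conv f′ g′ k
  conv-cong f≈f′ g≈g′ zero    = *-cong (f≈f′ 0) (g≈g′ 0)
  conv-cong f≈f′ g≈g′ (suc k) =
    +-cong (*-cong (f≈f′ 0) (g≈g′ (suc k))) (conv-cong (f≈f′ ∘ suc) g≈g′ k)

  conv-+ˡ : ∀ f f′ g k → conv (λ i → f i + f′ i) g k ≈ conv f g k + conv f′ g k
  conv-+ˡ f f′ g zero    = distribʳ (g 0) (f 0) (f′ 0)
  conv-+ˡ f f′ g (suc k) = trans (+-congˡ (conv-+ˡ (tail f) (tail f′) g k))
    (solve 5 (λ a b h u v → (a :+ b) :* h :+ (u :+ v) := (a :* h :+ u) :+ (b :* h :+ v))
      refl (f 0) (f′ 0) (g (suc k)) (conv (tail f) g k) (conv (tail f′) g k))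

  conv-*ˡ : ∀ x f g k → conv (λ i → x * f i) g k ≈ x * conv f g k
  conv-*ˡ x f g zero    = *-assoc x (f 0) (g 0)
  conv-*ˡ x f g (suc k) = trans (+-congˡ (conv-*ˡ x (tail f) g k))
    (solve 4 (λ x a h u → x :* a :* h :+ x :* u := x :* (a :* h :+ u))
      refl x (f 0) (g (suc k)) (conv (tail f) g k))

  conv-*ʳ : ∀ x f g k → conv f (λ i → x * g i) k ≈ x * conv f g k
  conv-*ʳ x f g zero    = solve 3 (λ x a h → a :* (x :* h) := x :* (a :* h)) refl x (f 0) (g 0)
  conv-*ʳ x f g (suc k) = trans (+-congˡ (conv-*ʳ x (tail f) g k))
    (solve 4 (λ x a h u → a :* (x :* h) :+ x :* u := x :* (a :* h :+ u))
      refl x (f 0) (g (suc k)) (conv (tail f) g k))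

  conv-tailˡ : ∀ f g k → f 0 ≈ 0# → conv f g (suc k) ≈ conv (tail f) g k
  conv-tailˡ f g k f₀≈0 =
    trans (+-congʳ (trans (*-congʳ f₀≈0) (zeroˡ (g (suc k))))) (+-identityˡ (conv (tail f) g k))

  conv-tailʳ : ∀ f g k → g 0 ≈ 0# → conv f g (suc k) ≈ conv f (tail g) k
  conv-tailʳ f g zero    g₀≈0 =
    trans (+-congˡ (trans (*-congˡ g₀≈0) (zeroʳ (f 1)))) (+-identityʳ (f 0 * g 1))
  conv-tailʳ f g (suc k) g₀≈0 = +-congˡ (conv-tailʳ (tail f) g k g₀≈0)

  -- The Leibniz rule for the derivation `t d/dt` on power series.
  index-conv : ∀ f g k → conv (index f) g k + conv f (index g) k ≈ index (conv f g) k
  index-conv f g zero = solve 2 (λ a b → (# 0 :* a) :* b :+ a :* (# 0 :* b) := # 0 :* (a :* b))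
    refl (f 0) (g 0)
  index-conv f g (suc k) =
    trans (+-congʳ (+-congˡ (trans
      (conv-cong {g = g} (λ i → solve 2 (λ n a → (# 1 :+ n) :* a := n :* a :+ a) refl (fromℕ i) (f (suc i)))
        (λ _ → refl) k)
      (conv-+ˡ (index (tail f)) (tail f) g k))))
    (trans (solve 6 (λ n a b u v w →
        (# 0 :* a) :* b :+ (u :+ w) :+ (a :* ((# 1 :+ n) :* b) :+ v) :=
        (# 1 :+ n) :* (a :* b) :+ ((u :+ v) :+ w))
      refl (fromℕ k) (f 0) (g (suc k)) (conv (index (tail f)) g k) (conv (tail f) (index g) k)
      (conv (tail f) g k))
    (trans (+-congˡ (+-congʳ (index-conv (tail f) g k)))
      (solve 4 (λ n a b w → (# 1 :+ n) :* (a :* b) :+ (n :* w :+ w) := (# 1 :+ n) :* (a :* b :+ w))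
        refl (fromℕ k) (f 0) (g (suc k)) (conv (tail f) g k))))

  Σ-conv-suc : ∀ f g n →
    Σ[< suc n ] (conv f g) ≈ f 0 * Σ[< suc n ] g + Σ[< n ] (conv (tail f) g)
  Σ-conv-suc f g zero    = solve 2 (λ a b → # 0 :+ a :* b := a :* (# 0 :+ b) :+ # 0) refl (f 0) (g 0)
  Σ-conv-suc f g (suc n) = trans (+-congʳ (Σ-conv-suc f g n))
    (solve 5 (λ a s b u v → (a :* s :+ u) :+ (a :* b :+ v) := a :* (s :+ b) :+ (u :+ v))
      refl (f 0) (Σ[< suc n ] g) (g (suc n)) (Σ[< n ] (conv (tail f) g)) (conv (tail f) g n))

  -- The triangle `i + j < n` lies in the square `i, j < n`.
  Σ-conv-≤ : ∀ {f g} → Nonneg f → Nonneg g → ∀ n →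
    Σ[< n ] (conv f g) ≤ Σ[< n ] f * Σ[< n ] g
  Σ-conv-≤ 0≤f 0≤g zero = ≈⇒≤ (sym (zeroˡ 0#))
  Σ-conv-≤ {f} {g} 0≤f 0≤g (suc n) = ≤-trans (≈⇒≤ (Σ-conv-suc f g n)) (≤-trans
    (+-mono-≤ ≤-refl (≤-trans (Σ-conv-≤ (0≤f ∘ suc) 0≤g n)
      (*-monoˡ-≤ (Σ-nonneg (0≤f ∘ suc) n) (≤-by (0≤g n) refl))))
    (≈⇒≤ (trans (sym (distribʳ (Σ[< suc n ] g) (f 0) (Σ[< n ] (tail f))))
      (*-congʳ (sym (Σ-suc f n))))))

  -- The rectangle `i < m`, `j < n` lies in the triangle `i + j < m + n`.
  Σ-conv-≥ : ∀ {f g} → Nonneg f → Nonneg g → ∀ m n →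
    Σ[< m ] f * Σ[< n ] g ≤ Σ[< m ℕ.+ n ] (conv f g)
  Σ-conv-≥ 0≤f 0≤g zero n = ≤-trans (≈⇒≤ (zeroˡ _)) (Σ-nonneg (conv-nonneg 0≤f 0≤g) n)
    where
    conv-nonneg : ∀ {f g} → Nonneg f → Nonneg g → Nonneg (conv f g)
    conv-nonneg 0≤f 0≤g zero    = *-nonneg (0≤f 0) (0≤g 0)
    conv-nonneg 0≤f 0≤g (suc k) =
      *-nonneg (0≤f 0) (0≤g (suc k)) ⊕ conv-nonneg (0≤f ∘ suc) 0≤g k
  Σ-conv-≥ {f} {g} 0≤f 0≤g (suc m) n = ≤-trans
    (≈⇒≤ (trans (*-congʳ (Σ-suc f m)) (distribʳ (Σ[< n ] g) (f 0) (Σ[< m ] (tail f)))))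
    (≤-trans (+-mono-≤
      (*-monoˡ-≤ (0≤f 0) (Σ-monoˡ-≤ 0≤g (ℕ.m≤n+m n (suc m))))
      (Σ-conv-≥ (0≤f ∘ suc) 0≤g m n))
      (≈⇒≤ (sym (Σ-conv-suc f g (m ℕ.+ n)))))

  expTerm : Carrier → Sequence
  expTerm x n = x ^ n / fromℕ (n !) [ fromℕ-pos (ℕ.1≤n! n) ]

  expSum≈Σ : ∀ x n → expSum x n ≈ Σ[< n ] (expTerm x)
  expSum≈Σ x zero    = refl
  expSum≈Σ x (suc n) = +-congʳ (expSum≈Σ x n)

  fromℕ!*expTerm : ∀ x n → fromℕ (n !) * expTerm x n ≈ x ^ n
  fromℕ!*expTerm x n = *-*-inv (x ^ n) (fromℕ-pos (ℕ.1≤n! n))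

  *-cancelˡ-≈ : ∀ {z x y} → 0# < z → z * x ≈ z * y → x ≈ y
  *-cancelˡ-≈ {z} {x} {y} 0<z zx≈zy = trans (expand x)
    (trans (*-congˡ zx≈zy) (sym (expand y)))
    where
    expand : ∀ t → t ≈ inv z 0<z * (z * t)
    expand t = trans (sym (*-identityˡ t))
      (trans (*-congʳ (sym (inv-inverseˡ z 0<z))) (*-assoc (inv z 0<z) z t))

  expTerm-suc : ∀ x n → fromℕ (suc n) * expTerm x (suc n) ≈ x * expTerm x n
  expTerm-suc x n = *-cancelˡ-≈ (fromℕ-pos (ℕ.1≤n! n)) (trans
    (trans (solve 3 (λ m f t → f :* (m :* t) := (m :* f) :* t) refl
        (fromℕ (suc n)) (fromℕ (n !)) (expTerm x (suc n)))
      (*-congʳ (sym (fromℕ-* (suc n) (n !)))))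
    (trans (fromℕ!*expTerm x (suc n)) (trans (*-congˡ (sym (fromℕ!*expTerm x n)))
      (solve 3 (λ x f t → x :* (f :* t) := f :* (x :* t)) refl x (fromℕ (n !)) (expTerm x n)))))

  expTerm-nonneg : ∀ {x} → 0# ≤ x → Nonneg (expTerm x)
  expTerm-nonneg 0≤x n = *-nonneg (^-nonneg 0≤x n) (<⇒≤ (inv-pos (fromℕ (n !)) _))

  expTerm-zero : ∀ x → expTerm x 0 ≈ 1#
  expTerm-zero x = trans
    (solve 1 (λ t → t := (# 1 :+ # 0) :* t) refl (expTerm x 0)) (fromℕ!*expTerm x 0)

  -- The binomial theorem without binomial coefficients: both sides satisfy the recurrence
  -- `(k + 1) tₖ₊₁ = (x + y) tₖ`, on the right by the Leibniz rule.
  expTerm-+ : ∀ x y k → expTerm (x + y) k ≈ conv (expTerm x) (expTerm y) k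
  expTerm-+ x y zero = trans (expTerm-zero (x + y)) (trans (sym (*-identityˡ 1#))
    (sym (*-cong (expTerm-zero x) (expTerm-zero y))))
  expTerm-+ x y (suc k) = *-cancelˡ-≈ (fromℕ-pos {suc k} (ℕ.s≤s ℕ.z≤n)) (begin
    fromℕ (suc k) * expTerm (x + y) (suc k)
      ≈⟨ expTerm-suc (x + y) k ⟩
    (x + y) * expTerm (x + y) k
      ≈⟨ *-congˡ (expTerm-+ x y k) ⟩
    (x + y) * conv f g k
      ≈⟨ distribʳ (conv f g k) x y ⟩
    x * conv f g k + y * conv f g k
      ≈⟨ +-cong (conv-*ˡ x f g k) (conv-*ʳ y f g k) ⟨
    conv (λ i → x * f i) g k + conv f (λ i → y * g i) k
      ≈⟨ +-cong (conv-cong {g = g} (expTerm-suc x) (λ _ → refl) k)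
                (conv-cong {f = f} (λ _ → refl) (expTerm-suc y) k) ⟨
    conv (tail (index f)) g k + conv f (tail (index g)) k
      -- An `index` sequence starts with 0, so dropping its first term only shifts the product.
      ≈⟨ +-cong (conv-tailˡ (index f) g k (zeroˡ (f 0)))
                (conv-tailʳ f (index g) k (zeroˡ (g 0))) ⟨
    conv (index f) g (suc k) + conv f (index g) (suc k)
      ≈⟨ index-conv f g (suc k) ⟩
    fromℕ (suc k) * conv f g (suc k) ∎)
    where
    f = expTerm x
    g = expTerm y

  expSum-cong : ∀ {x y} → x ≈ y → ∀ n → expSum x n ≈ expSum y n
  expSum-cong x≈y zero    = refl
  expSum-cong x≈y (suc n) = +-cong (expSum-cong x≈y n) (*-congʳ (^-congˡ n x≈y))

  expSum-nonneg : ∀ {x} → 0# ≤ x → ∀ n → 0# ≤ expSum x n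
  expSum-nonneg 0≤x zero    = ≤-refl
  expSum-nonneg 0≤x (suc n) = expSum-nonneg 0≤x n ⊕ expTerm-nonneg 0≤x n

  expSum-monoʳ-≤ : ∀ {x} → 0# ≤ x → ∀ {m n} → m ℕ.≤ n → expSum x m ≤ expSum x n
  expSum-monoʳ-≤ {x} 0≤x {m} {n} m≤n = ≤-trans (≈⇒≤ (expSum≈Σ x m))
    (≤-trans (Σ-monoˡ-≤ (expTerm-nonneg 0≤x) m≤n) (≈⇒≤ (sym (expSum≈Σ x n))))

  expSum-+ : ∀ x y n → expSum (x + y) n ≈ Σ[< n ] (conv (expTerm x) (expTerm y))
  expSum-+ x y n = trans (expSum≈Σ (x + y) n) (Σ-cong (expTerm-+ x y) n)

  expSum-+-≤ : ∀ {x y} → 0# ≤ x → 0# ≤ y → ∀ n →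
    expSum (x + y) n ≤ expSum x n * expSum y n
  expSum-+-≤ {x} {y} 0≤x 0≤y n = ≤-trans (≈⇒≤ (expSum-+ x y n)) (≤-trans
    (Σ-conv-≤ (expTerm-nonneg 0≤x) (expTerm-nonneg 0≤y) n)
    (≈⇒≤ (sym (*-cong (expSum≈Σ x n) (expSum≈Σ y n)))))

  expSum-+-≥ : ∀ {x y} → 0# ≤ x → 0# ≤ y → ∀ m n →
    expSum x m * expSum y n ≤ expSum (x + y) (m ℕ.+ n)
  expSum-+-≥ {x} {y} 0≤x 0≤y m n = ≤-trans
    (≈⇒≤ (*-cong (expSum≈Σ x m) (expSum≈Σ y n))) (≤-trans
    (Σ-conv-≥ (expTerm-nonneg 0≤x) (expTerm-nonneg 0≤y) m n)
    (≈⇒≤ (sym (expSum-+ x y (m ℕ.+ n)))))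

  fromℕ-suc-* : ∀ n x → fromℕ (suc n) * x ≈ x + fromℕ n * x
  fromℕ-suc-* n x = solve 2 (λ m x → (# 1 :+ m) :* x := x :+ m :* x) refl (fromℕ n) x

  expSum-1 : ∀ x → expSum x 1 ≈ 1#
  expSum-1 x = trans (+-identityˡ (expTerm x 0)) (expTerm-zero x)

  expSum-0-≤ : ∀ {x} → x ≈ 0# → ∀ n → expSum x n ≤ 1#
  expSum-0-≤ x≈0 zero = 0≤1
  expSum-0-≤ {x} x≈0 (suc zero) = ≈⇒≤ (expSum-1 x)
  expSum-0-≤ {x} x≈0 (suc (suc n)) = ≤-trans
    (≈⇒≤ (trans (+-congˡ (trans (*-congʳ (trans (*-congʳ x≈0) (zeroˡ (x ^ n)))) (zeroˡ _)))
      (+-identityʳ (expSum x (suc n)))))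
    (expSum-0-≤ x≈0 (suc n))

  expSum-·-≤ : ∀ {x} → 0# ≤ x → ∀ n N → expSum (fromℕ n * x) N ≤ expSum x N ^ n
  expSum-·-≤ {x} 0≤x zero    N = expSum-0-≤ (zeroˡ x) N
  expSum-·-≤ {x} 0≤x (suc n) N = ≤-trans (≈⇒≤ (expSum-cong (fromℕ-suc-* n x) N))
    (≤-trans (expSum-+-≤ 0≤x (*-nonneg (fromℕ-nonneg n) 0≤x) N)
      (*-monoˡ-≤ (expSum-nonneg 0≤x N) (expSum-·-≤ 0≤x n N)))

  -- The extra term `+ 1` serves `n = 0`, where the empty power 1 needs one term of the series.
  expSum-·-≥ : ∀ {x} → 0# ≤ x → ∀ m n →
    expSum x m ^ n ≤ expSum (fromℕ n * x) (n ℕ.* m ℕ.+ 1)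
  expSum-·-≥ {x} 0≤x m zero    = ≈⇒≤ (sym (expSum-1 (0# * x)))
  expSum-·-≥ {x} 0≤x m (suc n) = ≤-trans
    (*-monoˡ-≤ (expSum-nonneg 0≤x m) (expSum-·-≥ 0≤x m n))
    (≤-trans (expSum-+-≥ 0≤x (*-nonneg (fromℕ-nonneg n) 0≤x) m (n ℕ.* m ℕ.+ 1))
      (≈⇒≤ (trans (expSum-cong (sym (fromℕ-suc-* n x)) (m ℕ.+ (n ℕ.* m ℕ.+ 1)))
        (reflexive (≡.cong (expSum (fromℕ (suc n) * x)) (≡.sym (ℕ.+-assoc m (n ℕ.* m) 1)))))))

  -- The coefficient of xᵏ in (2 − x) eˣ is (2 − k) / k!, which is not positive
  -- from k = 2 on; the term n xⁿ / n! is the truncation error.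
  expSum-trapezoid : ∀ {x} → 0# ≤ x → ∀ n →
    expSum x n * (fromℕ 2 - x) + fromℕ n * expTerm x n ≤ fromℕ 2 + x
  expSum-trapezoid {x} 0≤x zero = ≤-by (fromℕ-nonneg 2 ⊕ 0≤x)
    (solve 2 (λ x t → # 0 :* (# 2 :- x) :+ # 0 :* t :+ (# 2 :+ x) := # 2 :+ x)
      refl x (expTerm x 0))
  expSum-trapezoid {x} 0≤x (suc n) = ≤-trans (≈⇒≤ telescope) (bound n)
    where
    telescope : expSum x (suc n) * (fromℕ 2 - x) + fromℕ (suc n) * expTerm x (suc n) ≈
      expSum x n * (fromℕ 2 - x) + fromℕ 2 * expTerm x n
    telescope = trans (+-congˡ (expTerm-suc x n))
      (solve 3 (λ x s t → (s :+ t) :* (# 2 :- x) :+ x :* t := s :* (# 2 :- x) :+ # 2 :* t)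
        refl x (expSum x n) (expTerm x n))
    bound : ∀ n → expSum x n * (fromℕ 2 - x) + fromℕ 2 * expTerm x n ≤ fromℕ 2 + x
    bound zero = ≤-by 0≤x (trans (+-congʳ (+-congˡ (*-congˡ (expTerm-zero x))))
      (solve 1 (λ x → # 0 :* (# 2 :- x) :+ # 2 :* # 1 :+ x := # 2 :+ x) refl x))
    bound (suc zero) = ≈⇒≤ (trans (+-cong (*-congʳ (expSum-1 x)) (*-congˡ expTerm-one))
      (solve 1 (λ x → # 1 :* (# 2 :- x) :+ # 2 :* x := # 2 :+ x) refl x))
      where
      expTerm-one : expTerm x 1 ≈ x
      expTerm-one = trans (solve 1 (λ t → t := (# 1 :+ # 0) :* t) refl (expTerm x 1))
        (trans (expTerm-suc x 0) (trans (*-congˡ (expTerm-zero x)) (*-identityʳ x)))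
    -- From index 2 on, the coefficient 2 is at most the index, so the truncation term of the main
    -- inequality dominates. The call returns to `bound (suc n)`, which is smaller.
    bound (suc (suc n)) = ≤-trans
      (≤-by (*-nonneg (fromℕ-nonneg n) (expTerm-nonneg 0≤x (2 ℕ.+ n)))
        (solve 3 (λ m u t → u :+ # 2 :* t :+ m :* t := u :+ (# 1 :+ (# 1 :+ m)) :* t) refl
          (fromℕ n) (expSum x (2 ℕ.+ n) * (fromℕ 2 - x)) (expTerm x (2 ℕ.+ n))))
      (expSum-trapezoid 0≤x (suc (suc n)))

  -- The coefficient of xᵏ in (12 − 6 x + x²) eˣ is (k − 3) (k − 4) / k!, and with
  -- seven terms the truncation leaves no negative coefficient.
  expSum-padé : ∀ {x} → 0# < x →
    fromℕ 12 + fromℕ 6 * x + x * x < expSum x 7 * (fromℕ 12 - fromℕ 6 * x + x * x)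
  -- Scaling by `720 = 6 !` clears all denominators, and `12 x⁵ + 6 x⁶ + x⁸` is then the exact
  -- excess of the right side.
  expSum-padé {x} 0<x = *-cancelˡ-< (fromℕ-pos {720} (ℕ.s≤s ℕ.z≤n)) (<-by
    (+-pos (+-pos (*-pos (fromℕ-pos {12} (ℕ.s≤s ℕ.z≤n)) (^-pos 0<x 5))
      (*-pos (fromℕ-pos {6} (ℕ.s≤s ℕ.z≤n)) (^-pos 0<x 6))) (^-pos 0<x 8))
    (trans (solve 1 (λ x →
        # 720 :* (# 12 :+ # 6 :* x :+ x :* x) :+ (# 12 :* x :^ 5 :+ # 6 :* x :^ 6 :+ x :^ 8) :=
        (# 0 :+ # 720 :* x :^ 0 :+ # 720 :* x :^ 1 :+ # 360 :* x :^ 2 :+ # 120 :* x :^ 3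
          :+ # 30 :* x :^ 4 :+ # 6 :* x :^ 5 :+ # 1 :* x :^ 6) :* (# 12 :- # 6 :* x :+ x :* x))
        refl x)
      (trans (*-congʳ (sym scaled)) (*-assoc (fromℕ 720) (expSum x 7) _))))
    where
    term : ∀ m k → fromℕ (m ℕ.* k !) * expTerm x k ≈ fromℕ m * x ^ k
    term m k = trans (*-congʳ (fromℕ-* m (k !)))
      (trans (*-assoc (fromℕ m) (fromℕ (k !)) (expTerm x k)) (*-congˡ (fromℕ!*expTerm x k)))
    scaled : fromℕ 720 * expSum x 7 ≈
      0# + fromℕ 720 * x ^ 0 + fromℕ 720 * x ^ 1 + fromℕ 360 * x ^ 2 + fromℕ 120 * x ^ 3
        + fromℕ 30 * x ^ 4 + fromℕ 6 * x ^ 5 + 1# * x ^ 6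
    scaled = trans
      (solve 8 (λ s a b c d e f g →
        s :* (# 0 :+ a :+ b :+ c :+ d :+ e :+ f :+ g) :=
        # 0 :+ s :* a :+ s :* b :+ s :* c :+ s :* d :+ s :* e :+ s :* f :+ s :* g) refl
        (fromℕ 720) (expTerm x 0) (expTerm x 1) (expTerm x 2) (expTerm x 3)
        (expTerm x 4) (expTerm x 5) (expTerm x 6))
      (+-cong (+-cong (+-cong (+-cong (+-cong (+-cong (+-cong refl
        (term 720 0)) (term 720 1)) (term 360 2)) (term 120 3)) (term 30 4)) (term 6 5))
        (trans (term 1 6) (*-congʳ (+-identityʳ 1#))))

  -- Two terms already contain the linear one, which alone contributes `y − x`. A gap independent of
  -- `n` survives the limit, as mere strictness would not.
  expSum-increment : ∀ {x y} → 0# ≤ x → x ≤ y → ∀ n →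
    expSum x (2 ℕ.+ n) + (y - x) ≤ expSum y (2 ℕ.+ n)
  expSum-increment {x} {y} 0≤x x≤y zero = ≈⇒≤ (trans (+-congʳ (expand x))
    (trans (solve 2 (λ x y → # 1 :+ x :+ (y :- x) := # 1 :+ y) refl x y) (sym (expand y))))
    where
    expand : ∀ t → expSum t 2 ≈ 1# + t
    expand t = +-cong (expSum-1 t) (trans
      (solve 1 (λ u → u := (# 1 :+ # 0) :* u) refl (expTerm t 1)) (trans (fromℕ!*expTerm t 1) (*-identityʳ t)))
  expSum-increment {x} {y} 0≤x x≤y (suc n) = ≤-trans
    (≈⇒≤ (solve 3 (λ s e d → s :+ e :+ d := s :+ d :+ e) refl
      (expSum x (2 ℕ.+ n)) (expTerm x (2 ℕ.+ n)) (y - x)))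
    (+-mono-≤ (expSum-increment 0≤x x≤y n)
      (*-mono-≤ (^-nonneg 0≤x (2 ℕ.+ n)) (<⇒≤ (inv-pos (fromℕ ((2 ℕ.+ n) !)) _))
        (^-mono-≤ 0≤x x≤y (2 ℕ.+ n)) ≤-refl))

  expSum-≤-IsExp : ∀ {x θ} → 0# ≤ x → IsExp x θ → ∀ n → expSum x n ≤ θ
  expSum-≤-IsExp 0≤x x⟶θ n = ⟶-≥ x⟶θ n (λ _ → expSum-monoʳ-≤ 0≤x)

  IsExp-injective-≤ : ∀ {x y θ} → 0# ≤ x → IsExp x θ → IsExp y θ → y ≤ x
  IsExp-injective-≤ {x} {y} {θ} 0≤x x⟶θ y⟶θ x<y = ⟶-≤ x⟶θ 2 gap
    (<-by (x<y⇒0<y-x x<y) (solve 2 (λ θ d → θ :- d :+ d := θ) refl θ (y - x)))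
    where
    gap : ∀ n → 2 ℕ.≤ n → expSum x n ≤ θ - (y - x)
    gap (suc zero) (ℕ.s≤s ())
    gap (suc (suc n)) _ = ≤-trans (≈⇒≤
      (solve 2 (λ s d → s := s :+ d :- d) refl (expSum x (2 ℕ.+ n)) (y - x)))
      (+-mono-≤ (≤-trans (expSum-increment 0≤x (<⇒≤ x<y) n)
        (expSum-≤-IsExp (<⇒≤ (≤-<-trans 0≤x x<y)) y⟶θ (2 ℕ.+ n))) ≤-refl)

  -- `IsApprox` supplies a logarithm of its own, which has to be identified with the given one.
  IsExp-injective : ∀ {x y θ} → 0# ≤ x → 0# ≤ y → IsExp x θ → IsExp y θ → x ≈ y
  IsExp-injective {x} {y} 0≤x 0≤y x⟶θ y⟶θ = proj₁ (tight x y) ¬x#y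
    where
    ¬x#y : ¬ (x # y)
    ¬x#y x#y with #⇒<⊎> x#y
    ... | inj₁ x<y = IsExp-injective-≤ 0≤x x⟶θ y⟶θ x<y
    ... | inj₂ y<x = IsExp-injective-≤ 0≤y y⟶θ x⟶θ y<x

  -- Padé bounds on the n-th root

  module RootBounds {l θ r : Carrier} {n : ℕ} (0<n : 0 ℕ.< n) (0<l : 0# < l)
    (l⟶θ : IsExp l θ) (r-root : IsRoot n θ r)
    {x : Carrier} (nx≈l : fromℕ n * x ≈ l) where

    0<x : 0# < x
    0<x = *-cancelˡ-< (fromℕ-pos 0<n)
      (<-respˡ-≈ (sym (zeroʳ (fromℕ n))) (<-respʳ-≈ (sym nx≈l) 0<l))

    -- Stated without division, so that `x ≥ 2` is covered: refuting the reverse strict inequality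
    -- supplies `0 < 2 − x`. Then every partial sum at `x` is at most `B`, hence every partial sum
    -- at `n x` is at most `Bⁿ`, and so is `θ = rⁿ`.
    root-≤ : (fromℕ 2 - x) * r ≤ fromℕ 2 + x
    root-≤ 2+x<⟨2-x⟩r = ≤/⇒*≤ 0<2-x r≤B 2+x<⟨2-x⟩r
      where
      0<2+x : 0# < fromℕ 2 + x
      0<2+x = +-pos (fromℕ-pos {2} (ℕ.s≤s ℕ.z≤n)) 0<x
      0<2-x : 0# < fromℕ 2 - x
      0<2-x = *-cancelˡ-< (proj₁ r-root) (<-respˡ-≈ (sym (zeroʳ r))
        (<-respʳ-≈ (*-comm (fromℕ 2 - x) r) (<-trans 0<2+x 2+x<⟨2-x⟩r)))
      B : Carrier
      B = (fromℕ 2 + x) / (fromℕ 2 - x) [ 0<2-x ]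
      sum≤B : ∀ N → expSum x N ≤ B
      sum≤B N = *≤⇒≤/ 0<2-x (≤-trans
        (≤-by (*-nonneg (fromℕ-nonneg N) (expTerm-nonneg (<⇒≤ 0<x) N))
          (+-congʳ (*-comm (fromℕ 2 - x) (expSum x N))))
        (expSum-trapezoid (<⇒≤ 0<x) N))
      r≤B : r ≤ B
      r≤B = ^-cancel-≤ 0<n (<⇒≤ (*-pos 0<2+x (inv-pos (fromℕ 2 - x) 0<2-x)))
        (≤-trans (≈⇒≤ (proj₂ r-root)) (⟶-≤ l⟶θ 0 (λ N _ → ≤-trans
          (≈⇒≤ (expSum-cong (sym nx≈l) N))
          (≤-trans (expSum-·-≤ (<⇒≤ 0<x) n N)
            (^-mono-≤ (expSum-nonneg (<⇒≤ 0<x) N) (sum≤B N) n)))))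

    -- Seven terms suffice because `(expSum x 7)ⁿ` is at most a partial sum at `n x`, hence at most
    -- `θ = rⁿ`.
    root-> : fromℕ 12 + fromℕ 6 * x + x * x < (fromℕ 12 - fromℕ 6 * x + x * x) * r
    root-> = <-≤-trans (expSum-padé 0<x) (≤-trans (≈⇒≤ (*-comm (expSum x 7) _))
      (*-monoˡ-≤ (<⇒≤ 0<D) (^-cancel-≤ 0<n (<⇒≤ (proj₁ r-root)) (≤-trans
        (expSum-·-≥ (<⇒≤ 0<x) 7 n)
        (≤-trans (≈⇒≤ (expSum-cong nx≈l (n ℕ.* 7 ℕ.+ 1)))
          (≤-trans (expSum-≤-IsExp (<⇒≤ 0<l) l⟶θ (n ℕ.* 7 ℕ.+ 1))
            (≈⇒≤ (sym (proj₂ r-root)))))))))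
      where
      -- Read off from `expSum-padé`: `D` times a positive sum exceeds a positive number.
      0<D : 0# < fromℕ 12 - fromℕ 6 * x + x * x
      0<D = *-cancelˡ-< 0<sum (<-respˡ-≈ (sym (zeroʳ (expSum x 7))) (<-trans
        (+-pos (+-pos (fromℕ-pos {12} (ℕ.s≤s ℕ.z≤n))
          (*-pos (fromℕ-pos {6} (ℕ.s≤s ℕ.z≤n)) 0<x)) (*-pos 0<x 0<x))
        (expSum-padé 0<x)))
        where
        0<sum : 0# < expSum x 7
        0<sum = <-≤-trans (<-respʳ-≈ (sym (expSum-1 x)) 0<1)
          (expSum-monoʳ-≤ (<⇒≤ 0<x) {1} {7} (ℕ.s≤s ℕ.z≤n))

  -- Comparison of the two floors

  fromℤ-mono-≤ : ∀ {i j} → i ℤ.≤ j → fromℤ i ≤ fromℤ j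
  fromℤ-mono-≤ (ℤ.+≤+ m≤n) = fromℕ-mono-≤ m≤n
  fromℤ-mono-≤ (ℤ.-≤+ {m} {n}) = ≤-by (fromℕ-nonneg n ⊕ fromℕ-nonneg (suc m))
    (solve 2 (λ m n → :- m :+ (n :+ m) := n) refl (fromℕ (suc m)) (fromℕ n))
  fromℤ-mono-≤ (ℤ.-≤- {m} {n} n≤m) = ≤-by (x≤y⇒0≤y-x (fromℕ-mono-≤ (ℕ.s≤s n≤m)))
    (solve 2 (λ m n → :- m :+ (m :- n) := :- n) refl (fromℕ (suc m)) (fromℕ (suc n)))

  fromℤ-suc-≤ : ∀ {i j} → i ℤ.< j → fromℤ i + 1# ≤ fromℤ j
  fromℤ-suc-≤ {i} {j} i<j = ≤-trans
    (≈⇒≤ (trans (+-comm (fromℤ i) 1#) (trans (+-congʳ (sym (+-identityʳ 1#)))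
      (sym (fromℤ-+ (+ 1) i)))))
    (fromℤ-mono-≤ (ℤ.i<j⇒suc[i]≤j i<j))

  2½≈1 : fromℕ 2 * ½ ≈ 1#
  2½≈1 = *-*-inv 1# (fromℕ-pos {2} (ℕ.s≤s ℕ.z≤n))

  -- In the application x = log θ / n, v = n / log θ and r = θ^{1/n}.
  module FloorComparison {x v w r : Carrier}
    (0<x : 0# < x) (0<w : 0# < w) (⟨r-1⟩w≈1 : (r - 1#) * w ≈ 1#) (xv≈1 : x * v ≈ 1#)
    (root-≤ : (fromℕ 2 - x) * r ≤ fromℕ 2 + x)
    (root-> : fromℕ 12 + fromℕ 6 * x + x * x < (fromℕ 12 - fromℕ 6 * x + x * x) * r)
    where

    private
      0<2 : 0# < fromℕ 2
      0<2 = fromℕ-pos {2} (ℕ.s≤s ℕ.z≤n)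

    -- After scaling by `2 x`, the difference is `w` times the slack in `root-≤`; the other summands
    -- only absorb the defining equations.
    v-½≤w : v - ½ ≤ w
    v-½≤w = *-cancelˡ-≤ (*-pos 0<2 0<x) (≤-by
      (*-pos-nonneg 0<w (x≤y⇒0≤y-x root-≤) ⊕ ≈⇒0≤ (fromℕ 2 - x) (sym ⟨r-1⟩w≈1)
        ⊕ ≈⇒0≤ (fromℕ 2) xv≈1 ⊕ ≈⇒0≤ x (sym 2½≈1))
      (solve 5 (λ x v w r h → # 2 :* x :* (v :- h) :+
          (w :* (# 2 :+ x :- (# 2 :- x) :* r) :+ (# 2 :- x) :* ((r :- # 1) :* w :- # 1)
            :+ # 2 :* (# 1 :- x :* v) :+ x :* (# 2 :* h :- # 1))
        := # 2 :* x :* w) refl x v w r ½))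

    -- Divided by `12 x`, this reads `w < 1/x − 1/2 + x/12`.
    12xw< : fromℕ 12 * x * w < fromℕ 12 - fromℕ 6 * x + x * x
    12xw< = <-by (+-pos-nonneg (*-pos 0<w (x<y⇒0<y-x root->))
        (≈⇒0≤ (fromℕ 12 - fromℕ 6 * x + x * x) ⟨r-1⟩w≈1))
      (solve 3 (λ x w r → # 12 :* x :* w :+
          (w :* ((# 12 :- # 6 :* x :+ x :* x) :* r :- (# 12 :+ # 6 :* x :+ x :* x))
            :+ (# 12 :- # 6 :* x :+ x :* x) :* (# 1 :- (r :- # 1) :* w))
        := # 12 :- # 6 :* x :+ x :* x) refl x w r)

    module _ {n ℓ k p : Carrier} (0<n : 0# < n) (1≤ℓ : 1# ≤ ℓ)
      (xnℓ≈2 : x * (n * ℓ) ≈ fromℕ 2) (p≈ : p ≈ 1# + fromℕ 2 * k) where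

      nℓ<p : v - ½ < k → n * ℓ < p
      nℓ<p v-½<k = <-respˡ-≈ (sym nℓ≈2v) (<-respʳ-≈ (sym p≈) (<-by
        (+-pos-nonneg (*-pos 0<2 (x<y⇒0<y-x v-½<k)) (≈⇒0≤ 1# 2½≈1))
        (solve 3 (λ v h k → # 2 :* v :+ (# 2 :* (k :- (v :- h)) :+ # 1 :* (# 1 :- # 2 :* h))
          := # 1 :+ # 2 :* k) refl v ½ k)))
        where
        nℓ≈2v : n * ℓ ≈ fromℕ 2 * v
        nℓ≈2v = *-cancelˡ-≈ 0<x (trans xnℓ≈2 (sym (trans
          (solve 3 (λ x t v → x :* (t :* v) := t :* (x :* v)) refl x (fromℕ 2) v)
          (trans (*-congˡ xv≈1) (*-identityʳ (fromℕ 2))))))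

      -- Doubling the gap `x / 12` gives `6 d < x`, and `x n ℓ = 2` turns this into `3 n d ℓ < 1`.
      -- The assumption to be refuted makes `3 n d` nonnegative, so that `1 ≤ ℓ` can be multiplied
      -- in.
      3nd≱1 : k ≤ w → ¬ (1# ≤ fromℕ 3 * (n * (p - n * ℓ)))
      3nd≱1 k≤w 1≤3nd = ≤-trans 1≤3nd 3nd≤3ndℓ 3ndℓ<1
        where
        d : Carrier
        d = p - n * ℓ
        3nd≤3ndℓ : fromℕ 3 * (n * d) ≤ fromℕ 3 * (n * d) * ℓ
        3nd≤3ndℓ = ≤-trans (≈⇒≤ (sym (*-identityʳ (fromℕ 3 * (n * d)))))
          (*-monoˡ-≤ (≤-trans 0≤1 1≤3nd) 1≤ℓ)
        6d<x : fromℕ 6 * d < x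
        6d<x = *-cancelˡ-< 0<x (<-by
          (+-pos-nonneg (x<y⇒0<y-x 12xw<)
            (*-nonneg (<⇒≤ (*-pos (fromℕ-pos {12} (ℕ.s≤s ℕ.z≤n)) 0<x)) (x≤y⇒0≤y-x k≤w)
              ⊕ ≈⇒0≤ (fromℕ 6 * x) p≈ ⊕ ≈⇒0≤ (fromℕ 6) (sym xnℓ≈2)))
          (solve 5 (λ x w k p nℓ → x :* (# 6 :* (p :- nℓ)) :+
              ((# 12 :- # 6 :* x :+ x :* x :- # 12 :* x :* w) :+
                (# 12 :* x :* (w :- k) :+ # 6 :* x :* (# 1 :+ # 2 :* k :- p)
                  :+ # 6 :* (x :* nℓ :- # 2)))
            := x :* x) refl x w k p (n * ℓ)))
        3ndℓ<1 : fromℕ 3 * (n * d) * ℓ < 1#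
        3ndℓ<1 = *-cancelˡ-< 0<2 (<-by
          (+-pos-nonneg (*-pos (*-pos 0<n (<-≤-trans 0<1 1≤ℓ)) (x<y⇒0<y-x 6d<x))
            (≈⇒0≤ 1# xnℓ≈2))
          (solve 4 (λ x n d ℓ → # 2 :* (# 3 :* (n :* d) :* ℓ) :+
              (n :* ℓ :* (x :- # 6 :* d) :+ # 1 :* (# 2 :- x :* (n :* ℓ)))
            := # 2 :* # 1) refl x n d ℓ))

  -- Fractions above the limit, and emptiness of the exceptional set

  open EvenConvergents

  convergent : ∀ b → Positive b → ℕ → Carrier
  convergent b b>0 k =
    fromℕ (numer b k) / fromℕ (denom b k) [ fromℕ-pos (0<denom b>0 k) ]

  -- The hypothesis is convergence of the even convergents, not a continued fraction expansion; both
  -- claims of the theorem can supply it.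
  module Approximation {b} (b>0 : Positive b) {ℓ : Carrier} (⟶ℓ : convergent b b>0 ⟶ ℓ) where

    private
      P Q X : ℕ → Carrier
      P k = fromℕ (numer b k)
      Q k = fromℕ (denom b k)
      X   = convergent b b>0

      0<Q : ∀ k → 0# < Q k
      0<Q k = fromℕ-pos (0<denom b>0 k)

      QX≈P : ∀ k → Q k * X k ≈ P k
      QX≈P k = *-*-inv (P k) (0<Q k)

    1≤limit : 1# ≤ ℓ
    1≤limit = ⟶-≥ ⟶ℓ 0 (λ k _ → *-cancelˡ-≤ (0<Q k) (≤-trans (≈⇒≤ (*-identityʳ (Q k)))
      (≤-trans (fromℕ-mono-≤ (denom≤numer b k)) (≈⇒≤ (sym (QX≈P k))))))

    convergent-gap : ∀ k p q → 0 ℕ.< q → fromℕ q * X k < fromℕ p →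
      1# ≤ fromℕ 3 * (fromℕ q * (fromℕ p - fromℕ q * X k))
    convergent-gap k p q 0<q qX<p = *-cancelˡ-≤ (0<Q k) (≤-trans
      (≤-trans (≈⇒≤ (*-identityʳ (Q k))) (fromℕ-mono-≤ (gap b>0 k p q D 0<q
        (ℕ.m<n⇒0<n∸m qP<pQ) (≡.sym (ℕ.m+[n∸m]≡n (ℕ.<⇒≤ qP<pQ))))))
      (≈⇒≤ (trans (trans (fromℕ-* 3 (q ℕ.* D)) (*-congˡ (trans (fromℕ-* q D) (*-congˡ D≈))))
        (solve 5 (λ t q p X Q → t :* (q :* (Q :* (p :- q :* X))) := Q :* (t :* (q :* (p :- q :* X))))
          refl (fromℕ 3) (fromℕ q) (fromℕ p) (X k) (Q k)))))
      where
      D : ℕ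
      D = p ℕ.* denom b k ℕ.∸ q ℕ.* numer b k
      qP≈ : fromℕ (q ℕ.* numer b k) ≈ Q k * (fromℕ q * X k)
      qP≈ = trans (fromℕ-* q (numer b k)) (trans (*-congˡ (sym (QX≈P k)))
        (solve 3 (λ q Q X → q :* (Q :* X) := Q :* (q :* X)) refl (fromℕ q) (Q k) (X k)))
      pQ≈ : fromℕ (p ℕ.* denom b k) ≈ Q k * fromℕ p
      pQ≈ = trans (fromℕ-* p (denom b k)) (*-comm (fromℕ p) (Q k))
      qP<pQ : q ℕ.* numer b k ℕ.< p ℕ.* denom b k
      qP<pQ = fromℕ-cancel-< (<-respˡ-≈ (sym qP≈) (<-respʳ-≈ (sym pQ≈) (*-monoˡ-< (0<Q k) qX<p)))
      D≈ : fromℕ D ≈ Q k * (fromℕ p - fromℕ q * X k)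
      D≈ = trans
        (solve 2 (λ d u → d := u :+ d :- u) refl (fromℕ D) (fromℕ (q ℕ.* numer b k)))
        (trans (+-cong (trans (sym (fromℕ-+ (q ℕ.* numer b k) D)) (trans
            (reflexive (≡.cong fromℕ (ℕ.m+[n∸m]≡n (ℕ.<⇒≤ qP<pQ)))) pQ≈)) (-‿cong qP≈))
          (solve 3 (λ Q p X → Q :* p :- Q :* X := Q :* (p :- X)) refl
            (Q k) (fromℕ p) (fromℕ q * X k)))

    -- The convergents are eventually below `p / q`, so `convergent-gap` applies to them. Its
    -- conclusion is rewritten by `scale` as a non-strict upper bound on `X k`, which passes to the
    -- limit.
    limit-gap : ∀ p q → 0 ℕ.< q → fromℕ q * ℓ < fromℕ p →
      1# ≤ fromℕ 3 * (fromℕ q * (fromℕ p - fromℕ q * ℓ))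
    limit-gap p q 0<q qℓ<p = bound (⟶-eventually-< ⟶ℓ (*<⇒</ 0<q′ qℓ<p))
      where
      q′ = fromℕ q
      p′ = fromℕ p
      0<q′ : 0# < q′
      0<q′ = fromℕ-pos 0<q
      0<3qq : 0# < fromℕ 3 * (q′ * q′)
      0<3qq = *-pos (fromℕ-pos {3} (ℕ.s≤s ℕ.z≤n)) (*-pos 0<q′ 0<q′)
      scale : ∀ {y} → 1# ≤ fromℕ 3 * (q′ * (p′ - q′ * y)) →
        fromℕ 3 * (q′ * q′) * y ≤ fromℕ 3 * q′ * p′ - 1#
      scale {y} 1≤ = ≤-by (x≤y⇒0≤y-x 1≤)
        (solve 4 (λ t q p y → t :* (q :* q) :* y :+ (t :* (q :* (p :- q :* y)) :- # 1)
            := t :* q :* p :- # 1) refl (fromℕ 3) q′ p′ y)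
      unscale : ∀ {y} → fromℕ 3 * (q′ * q′) * y ≤ fromℕ 3 * q′ * p′ - 1# →
        1# ≤ fromℕ 3 * (q′ * (p′ - q′ * y))
      unscale {y} ≤p = ≤-by (x≤y⇒0≤y-x ≤p)
        (solve 4 (λ t q p y → # 1 :+ (t :* q :* p :- # 1 :- t :* (q :* q) :* y)
          := t :* (q :* (p :- q :* y))) refl (fromℕ 3) q′ p′ y)
      bound : ∃[ N ] (∀ k → N ℕ.≤ k → X k < p′ / q′ [ 0<q′ ]) →
        1# ≤ fromℕ 3 * (q′ * (p′ - q′ * ℓ))
      bound (N , X<p/q) = unscale (≤/⇒*≤ 0<3qq (⟶-≤ ⟶ℓ N (λ k N≤k →
        *≤⇒≤/ 0<3qq (scale (convergent-gap k p q 0<q (</⇒*< 0<q′ (X<p/q k N≤k)))))))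

    𝒜-empty : ∀ {l θ} → 0# < l → l * ℓ ≈ fromℕ 2 → IsExp l θ → Empty (𝒜 θ)
    𝒜-empty {l} {θ} 0<l lℓ≈2 l⟶θ n
      (0<n , m , m′ , (r , 0<r-1 , r-root , m≤w , w<m+1) ,
        (l′ , 0<l′ , l′⟶θ , m′≤v-½ , v-½<m′+1) , m≢m′) = compare (ℤ.<-cmp m m′)
      where
      0<n′ : 0# < fromℕ n
      0<n′ = fromℕ-pos 0<n
      v w x : Carrier
      v = fromℕ n / l′ [ 0<l′ ]
      w = 1# / (r - 1#) [ 0<r-1 ]
      x = l′ / fromℕ n [ 0<n′ ]
      nx≈l′ : fromℕ n * x ≈ l′
      nx≈l′ = *-*-inv l′ 0<n′
      0<w : 0# < w
      0<w = *-pos 0<1 (inv-pos (r - 1#) 0<r-1)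
      xv≈1 : x * v ≈ 1#
      xv≈1 = *-cancelˡ-≈ 0<n′ (trans (sym (*-assoc (fromℕ n) x v)) (trans (*-congʳ nx≈l′)
        (trans (*-*-inv (fromℕ n) 0<l′) (sym (*-identityʳ (fromℕ n))))))
      xnℓ≈2 : x * (fromℕ n * ℓ) ≈ fromℕ 2
      xnℓ≈2 = trans (solve 3 (λ x n ℓ → x :* (n :* ℓ) := n :* x :* ℓ) refl x (fromℕ n) ℓ)
        (trans (*-congʳ (trans nx≈l′
          (IsExp-injective (<⇒≤ 0<l′) (<⇒≤ 0<l) l′⟶θ l⟶θ))) lℓ≈2)
      open RootBounds {r = r} 0<n 0<l′ l′⟶θ r-root {x} nx≈l′
      open FloorComparison {x} {v} {w} {r}
        0<x 0<w (*-*-inv 1# 0<r-1) xv≈1 root-≤ root->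

      above : ∀ m → fromℤ m ≤ w → w < fromℤ m + 1# → v - ½ < fromℤ m → ⊥
      above (+ k) k≤w _ v-½<k = 3nd≱1 0<n′ 1≤limit xnℓ≈2 p≈ k≤w
        (limit-gap p n 0<n (nℓ<p 0<n′ 1≤limit xnℓ≈2 p≈ v-½<k))
        where
        p : ℕ
        p = suc (2 ℕ.* k)
        p≈ : fromℕ p ≈ 1# + fromℕ 2 * fromℕ k
        p≈ = +-congˡ (fromℕ-* 2 k)
      -- The floor of the positive `w` is not negative, so `p` may be taken in the natural numbers.
      above -[1+ k ] _ w<m+1 _ = fromℕ-nonneg k (<-by (<-trans 0<w w<m+1)
        (solve 1 (λ k → k :+ (:- (# 1 :+ k) :+ # 1) := # 0) refl (fromℕ k)))

      compare : Tri (m ℤ.< m′) (m ≡ m′) (m′ ℤ.< m) → ⊥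
      -- The lower bound on `w` alone excludes this side.
      compare (tri< m<m′ _ _) =
        ≤-trans (fromℤ-suc-≤ m<m′) (≤-trans m′≤v-½ v-½≤w) w<m+1
      compare (tri≈ _ m≡m′ _) = m≢m′ m≡m′
      compare (tri> _ _ m′<m) =
        above m m≤w w<m+1 (<-≤-trans v-½<m′+1 (fromℤ-suc-≤ m′<m))

  -- Continued fractions

  -- With `k * 2` instead of `2 * k`, `suc k * 2` computes to two successors, so shifting `a` by two
  -- is definitionally a shift of `oddTerms a` by one.
  oddTerms : (ℕ → ℕ) → ℕ → ℕ
  oddTerms a k = a (suc (k ℕ.* 2))

  finiteCF-suc : ∀ a a>0 n → proj₁ (finiteCF a a>0 (suc n)) *
      proj₁ (finiteCF (a ∘ suc) (a>0 ∘ suc) n) ≈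
    fromℕ (a 0) * proj₁ (finiteCF (a ∘ suc) (a>0 ∘ suc) n) + 1#
  finiteCF-suc a a>0 n with finiteCF (a ∘ suc) (a>0 ∘ suc) n
  ... | x , 0<x = trans (distribʳ x (fromℕ (a 0)) _)
    (+-congˡ (trans (*-comm _ x) (*-*-inv 1# 0<x)))

  -- Two levels of the fraction are unfolded at once, in cross-multiplied form: `x y = y + 1` and
  -- `y z = a₁ z + 1`, with `Q′ z = P′` by induction.
  finiteCF-even : ∀ a a>0 → (∀ k → a (k ℕ.* 2) ≡ 1) → ∀ k →
    fromℕ (denom (oddTerms a) k) * proj₁ (finiteCF a a>0 (k ℕ.* 2)) ≈
      fromℕ (numer (oddTerms a) k)
  finiteCF-even a a>0 a₂ₖ≡1 zero = trans
    (*-congˡ (trans (reflexive (≡.cong fromℕ (a₂ₖ≡1 0))) (+-identityʳ 1#))) (*-identityʳ (fromℕ 1))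
  finiteCF-even a a>0 a₂ₖ≡1 (suc k) = *-cancelˡ-≈ 0<y (begin
    y * (fromℕ Q * x)                     ≈⟨ *-congˡ (*-congʳ Q≈) ⟩
    y * ((a₁ * P′ + Q′) * x)              ≈⟨ *-congˡ (*-congʳ yP′≈) ⟨
    y * (y * P′ * x)                      ≈⟨ solve 3 (λ x y P → y :* (y :* P :* x) := y :* (x :* y :* P)) refl x y P′ ⟩
    y * (x * y * P′)                      ≈⟨ *-congˡ (*-congʳ xy≈) ⟩
    y * ((y + 1#) * P′)                   ≈⟨ *-congˡ (solve 2 (λ y P → (y :+ # 1) :* P := y :* P :+ P) refl y P′) ⟩
    y * (y * P′ + P′)                     ≈⟨ *-congˡ (+-congʳ (trans yP′≈ (sym Q≈))) ⟩
    y * (fromℕ Q + P′)                    ≈⟨ *-congˡ (fromℕ-+ Q _) ⟨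
    y * fromℕ (numer (oddTerms a) (suc k)) ∎)
    where
    x y z P′ Q′ a₁ : Carrier
    x = proj₁ (finiteCF a a>0 (suc k ℕ.* 2))
    y = proj₁ (finiteCF (a ∘ suc) (a>0 ∘ suc) (suc (k ℕ.* 2)))
    z = proj₁ (finiteCF (a ∘ suc ∘ suc) (a>0 ∘ suc ∘ suc) (k ℕ.* 2))
    0<y : 0# < y
    0<y = proj₂ (finiteCF (a ∘ suc) (a>0 ∘ suc) (suc (k ℕ.* 2)))
    P′ = fromℕ (numer (oddTerms (a ∘ suc ∘ suc)) k)
    Q′ = fromℕ (denom (oddTerms (a ∘ suc ∘ suc)) k)
    a₁ = fromℕ (a 1)
    Q : ℕ
    Q = denom (oddTerms a) (suc k)
    Q≈ : fromℕ Q ≈ a₁ * P′ + Q′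
    Q≈ = trans (fromℕ-+ (a 1 ℕ.* numer (oddTerms (a ∘ suc ∘ suc)) k) _) (+-congʳ (fromℕ-* (a 1) _))
    Q′z≈P′ : Q′ * z ≈ P′
    Q′z≈P′ = finiteCF-even (a ∘ suc ∘ suc) (a>0 ∘ suc ∘ suc) (a₂ₖ≡1 ∘ suc) k
    yz≈ : y * z ≈ a₁ * z + 1#
    yz≈ = finiteCF-suc (a ∘ suc) (a>0 ∘ suc) (k ℕ.* 2)
    xy≈ : x * y ≈ y + 1#
    xy≈ = trans (finiteCF-suc a a>0 (suc (k ℕ.* 2))) (+-congʳ (trans
      (*-congʳ (trans (reflexive (≡.cong fromℕ (a₂ₖ≡1 0))) (+-identityʳ 1#))) (*-identityˡ y)))
    yP′≈ : y * P′ ≈ a₁ * P′ + Q′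
    yP′≈ = begin
      y * P′              ≈⟨ *-congˡ Q′z≈P′ ⟨
      y * (Q′ * z)        ≈⟨ solve 3 (λ y Q z → y :* (Q :* z) := Q :* (y :* z)) refl y Q′ z ⟩
      Q′ * (y * z)        ≈⟨ *-congˡ yz≈ ⟩
      Q′ * (a₁ * z + 1#)  ≈⟨ solve 3 (λ a Q z → Q :* (a :* z :+ # 1) := a :* (Q :* z) :+ Q) refl a₁ Q′ z ⟩
      a₁ * (Q′ * z) + Q′  ≈⟨ +-congʳ (*-congˡ Q′z≈P′) ⟩
      a₁ * P′ + Q′        ∎

  IsCF⇒convergent⟶ : ∀ {a a>0 ℓ} → (∀ k → a (k ℕ.* 2) ≡ 1) → IsCF a a>0 ℓ →
    convergent (oddTerms a) (λ k → a>0 (suc (k ℕ.* 2))) ⟶ ℓ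
  IsCF⇒convergent⟶ {a} {a>0} {ℓ} a₂ₖ≡1 cf ε 0<ε with cf ε 0<ε
  ... | N , near = N , λ k N≤k →
    let near-k = near (k ℕ.* 2) (ℕ.≤-trans N≤k (ℕ.m≤m*n k 2)) in
    <-respˡ-≈ (same k) (proj₁ near-k) , <-respʳ-≈ (+-congʳ (same k)) (proj₂ near-k)
    where
    b>0 : Positive (oddTerms a)
    b>0 k = a>0 (suc (k ℕ.* 2))
    same : ∀ k → proj₁ (finiteCF a a>0 (k ℕ.* 2)) ≈ convergent (oddTerms a) b>0 k
    same k = *-cancelˡ-≈ (fromℕ-pos (0<denom b>0 k)) (trans (finiteCF-even a a>0 a₂ₖ≡1 k)
      (sym (*-*-inv (fromℕ (numer (oddTerms a) k)) (fromℕ-pos (0<denom b>0 k)))))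

  -- ℓ = [1; c, 1, c, …] is the positive root of c ℓ² = c ℓ + 1.
  module Periodic {c : ℕ} (0<c : 0 ℕ.< c) {ℓ : Carrier} (0<ℓ : 0# < ℓ)
    (quadratic : fromℕ c * (ℓ * ℓ) ≈ fromℕ c * ℓ + 1#) where

    private
      b : ℕ → ℕ
      b _ = c

      C : Carrier
      C = fromℕ c

      P Q error : ℕ → Carrier
      P k = fromℕ (numer b k)
      Q k = fromℕ (denom b k)
      error k = Q k * ℓ - P k

      0<Cℓ : 0# < C * ℓ
      0<Cℓ = *-pos (fromℕ-pos 0<c) 0<ℓ

      0<Cℓ+1 : 0# < C * ℓ + 1#
      0<Cℓ+1 = +-pos 0<Cℓ 0<1

      1<ℓ : 1# < ℓ
      1<ℓ = *-cancelˡ-< 0<Cℓ (<-by 0<1 (trans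
        (+-congʳ (*-identityʳ (C * ℓ))) (trans (sym quadratic) (sym (*-assoc C ℓ ℓ)))))

      -- One period acts linearly on `(P, Q)`, and `Q ℓ − P` is an eigenform of this action with
      -- eigenvalue `1 / (C ℓ + 1)`. The quadratic equation is exactly what makes it one.
      error-suc : ∀ k → (C * ℓ + 1#) * error (suc k) ≈ error k
      error-suc k = begin
        (C * ℓ + 1#) * error (suc k)
          ≈⟨ *-congˡ (+-cong (*-congʳ Q≈) (-‿cong (trans (fromℕ-+ (denom b (suc k)) (numer b k)) (+-congʳ Q≈)))) ⟩
        (C * ℓ + 1#) * ((C * P k + Q k) * ℓ - ((C * P k + Q k) + P k))
          ≈⟨ solve 4 (λ C ℓ P Q → (C :* ℓ :+ # 1) :* ((C :* P :+ Q) :* ℓ :- ((C :* P :+ Q) :+ P)) :=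
              (Q :* ℓ :- P) :+ (C :* P :+ Q) :* (C :* (ℓ :* ℓ) :- (C :* ℓ :+ # 1))) refl C ℓ (P k) (Q k) ⟩
        error k + (C * P k + Q k) * (C * (ℓ * ℓ) - (C * ℓ + 1#))
          ≈⟨ +-congˡ (*-congˡ (trans (+-congʳ quadratic) (-‿inverseʳ (C * ℓ + 1#)))) ⟩
        error k + (C * P k + Q k) * 0#
          ≈⟨ trans (+-congˡ (zeroʳ _)) (+-identityʳ (error k)) ⟩
        error k ∎
        where
        Q≈ : Q (suc k) ≈ C * P k + Q k
        Q≈ = trans (fromℕ-+ (c ℕ.* numer b k) (denom b k)) (+-congʳ (fromℕ-* c (numer b k)))

      0≤error : ∀ k → 0# ≤ error k
      0≤error zero = ≤-trans (x≤y⇒0≤y-x (<⇒≤ 1<ℓ))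
        (≈⇒≤ (solve 1 (λ ℓ → ℓ :- # 1 := (# 1 :+ # 0) :* ℓ :- (# 1 :+ # 0)) refl ℓ))
      0≤error (suc k) = *-cancelˡ-≤ 0<Cℓ+1 (≤-trans (≈⇒≤ (zeroʳ (C * ℓ + 1#)))
        (≤-trans (0≤error k) (≈⇒≤ (sym (error-suc k)))))

      error≤ℓ : ∀ k → error k ≤ ℓ
      error≤ℓ zero = ≤-by 0≤1
        (solve 1 (λ ℓ → (# 1 :+ # 0) :* ℓ :- (# 1 :+ # 0) :+ # 1 := ℓ) refl ℓ)
      error≤ℓ (suc k) = ≤-trans
        (≤-by (*-nonneg (<⇒≤ 0<Cℓ) (0≤error (suc k)))
          (trans (solve 2 (λ u e → e :+ u :* e := (u :+ # 1) :* e) refl (C * ℓ) (error (suc k)))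
            (error-suc k)))
        (error≤ℓ k)

    -- The distance `ℓ − X k` is `error k / Q k`. A bounded error suffices, as `Q k > k`; hence `N`
    -- is chosen above `ℓ / ε`.
    convergent⟶ : convergent b (λ _ → 0<c) ⟶ ℓ
    convergent⟶ ε 0<ε with archimedean (ℓ / ε [ 0<ε ])
    ... | N , ℓ/ε<N = N , λ k N≤k → X<ℓ+ε k , ℓ<X+ε k N≤k
      where
      X : ℕ → Carrier
      X = convergent b (λ _ → 0<c)
      0<Q : ∀ k → 0# < Q k
      0<Q k = fromℕ-pos (0<denom (λ _ → 0<c) k)
      QX≈P : ∀ k → Q k * X k ≈ P k
      QX≈P k = *-*-inv (P k) (0<Q k)
      X<ℓ+ε : ∀ k → X k < ℓ + ε
      X<ℓ+ε k = ≤-<-trans (*-cancelˡ-≤ (0<Q k) (≤-trans (≈⇒≤ (QX≈P k))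
        (≤-by (0≤error k) (solve 2 (λ u p → p :+ (u :- p) := u) refl (Q k * ℓ) (P k)))))
        (<-by 0<ε refl)
      ℓ<εQ : ∀ k → N ℕ.≤ k → ℓ < ε * Q k
      ℓ<εQ k N≤k = <-≤-trans (<-respˡ-≈ (*-*-inv ℓ 0<ε) (*-monoˡ-< 0<ε ℓ/ε<N))
        (*-monoˡ-≤ (<⇒≤ 0<ε) (fromℕ-mono-≤
          (ℕ.≤-trans N≤k (ℕ.<⇒≤ (n<denom (λ _ → 0<c) k)))))
      ℓ<X+ε : ∀ k → N ℕ.≤ k → ℓ < X k + ε
      ℓ<X+ε k N≤k = *-cancelˡ-< (0<Q k) (<-by
        (+-pos-nonneg (x<y⇒0<y-x (ℓ<εQ k N≤k))
          (x≤y⇒0≤y-x (error≤ℓ k) ⊕ ≈⇒0≤ 1# (sym (QX≈P k))))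
        (solve 5 (λ Q ℓ P X ε → Q :* ℓ :+
            ((ε :* Q :- ℓ) :+ ((ℓ :- (Q :* ℓ :- P)) :+ # 1 :* (Q :* X :- P)))
          := Q :* (X :+ ε)) refl (Q k) ℓ (P k) (X k) ε))

  -- The two claims

  alternating-𝒜-empty : ∀ a a>0 → (∀ k → a (2 ℕ.* k) ≡ 1) →
    ∀ ℓ → IsCF a a>0 ℓ → (0<ℓ : 0# < ℓ) →
    ∀ θ → IsExp (fromℕ 2 / ℓ [ 0<ℓ ]) θ → Empty (𝒜 θ)
  alternating-𝒜-empty a a>0 a₂ₖ≡1 ℓ cf 0<ℓ θ = 𝒜-empty
    (*-pos (fromℕ-pos {2} (ℕ.s≤s ℕ.z≤n)) (inv-pos ℓ 0<ℓ))
    (trans (*-comm _ ℓ) (*-*-inv (fromℕ 2) 0<ℓ))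
    where
    open Approximation (λ k → a>0 (suc (k ℕ.* 2))) (IsCF⇒convergent⟶ {a} {a>0}
      (λ k → ≡.trans (≡.cong a (ℕ.*-comm k 2)) (a₂ₖ≡1 k)) cf)

  -- Here `u = log θ` satisfies `u² + 2 C u = 4 C`. Dividing by `u²` gives `C ℓ² = C ℓ + 1` for
  -- `ℓ = 2 / u`, the equation of the periodic fraction.
  sqrt-𝒜-empty : ∀ c → 0 ℕ.< c → ∀ s → IsSqrt (fromℕ (c ℕ.* (c ℕ.+ 4))) s →
    ∀ θ → IsExp (- fromℕ c + s) θ → Empty (𝒜 θ)
  sqrt-𝒜-empty c 0<c s (0≤s , ss≈) θ =
    Approximation.𝒜-empty (λ _ → 0<c) convergent⟶ 0<u uℓ≈2
    where
    C u : Carrier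
    C = fromℕ c
    u = - C + s
    0<C : 0# < C
    0<C = fromℕ-pos 0<c
    ss≈′ : s * s ≈ C * (C + fromℕ 4)
    ss≈′ = trans ss≈ (trans (fromℕ-* c (c ℕ.+ 4)) (*-congˡ (fromℕ-+ c 4)))
    0<4C : 0# < fromℕ 4 * C
    0<4C = *-pos (fromℕ-pos {4} (ℕ.s≤s ℕ.z≤n)) 0<C
    0<u : 0# < u
    -- The conjugate `C + s` is positive, and `(C + s) u = s² − C² = 4 C`.
    0<u = *-cancelˡ-< (+-pos-nonneg 0<C 0≤s) (<-by
      (+-pos-nonneg 0<4C (≈⇒0≤ 1# (sym ss≈′)))
      (solve 2 (λ C s → (C :+ s) :* # 0 :+ (# 4 :* C :+ # 1 :* (s :* s :- C :* (C :+ # 4)))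
        := (C :+ s) :* (:- C :+ s)) refl C s))
    ℓ : Carrier
    ℓ = fromℕ 2 / u [ 0<u ]
    uℓ≈2 : u * ℓ ≈ fromℕ 2
    uℓ≈2 = *-*-inv (fromℕ 2) 0<u
    uu≈ : u * u + fromℕ 2 * C * u ≈ fromℕ 4 * C
    uu≈ = trans
      (solve 2 (λ C s → (:- C :+ s) :* (:- C :+ s) :+ # 2 :* C :* (:- C :+ s) := s :* s :- C :* C) refl C s)
      (trans (+-congʳ ss≈′) (solve 1 (λ C → C :* (C :+ # 4) :- C :* C := # 4 :* C) refl C))
    quadratic : C * (ℓ * ℓ) ≈ C * ℓ + 1#
    quadratic = *-cancelˡ-≈ (*-pos 0<u 0<u) (begin
      u * u * (C * (ℓ * ℓ))
        ≈⟨ solve 3 (λ C u ℓ → u :* u :* (C :* (ℓ :* ℓ)) := C :* (u :* ℓ :* (u :* ℓ))) refl C u ℓ ⟩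
      C * (u * ℓ * (u * ℓ))
        ≈⟨ *-congˡ (*-cong uℓ≈2 uℓ≈2) ⟩
      C * (fromℕ 2 * fromℕ 2)
        ≈⟨ solve 1 (λ C → C :* (# 2 :* # 2) := # 4 :* C) refl C ⟩
      fromℕ 4 * C
        ≈⟨ uu≈ ⟨
      u * u + fromℕ 2 * C * u
        ≈⟨ +-congˡ (*-congʳ (*-congʳ uℓ≈2)) ⟨
      u * u + u * ℓ * C * u
        ≈⟨ solve 3 (λ C u ℓ → u :* u :+ u :* ℓ :* C :* u := u :* u :* (C :* ℓ :+ # 1)) refl C u ℓ ⟩
      u * u * (C * ℓ + 1#) ∎)
    open Periodic 0<c (*-pos (fromℕ-pos {2} (ℕ.s≤s ℕ.z≤n)) (inv-pos u 0<u)) quadratic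

theorem5 : ∀ {c ℓ₁ ℓ₂} (ℝ : RealField c ℓ₁ ℓ₂) →
    let open RealNotions ℝ in
    ((a : ℕ → ℕ) (a>0 : ∀ i → 0 ℕ.< a i) → (∀ k → a (2 ℕ.* k) ≡ 1) →
    ∀ ℓ → IsCF a a>0 ℓ → (0<ℓ : 0# < ℓ) →
    ∀ θ → IsExp (fromℕ 2 / ℓ [ 0<ℓ ]) θ →
    Empty (𝒜 θ))
    ×
    ((c : ℕ) → 0 ℕ.< c →
    ∀ s → IsSqrt (fromℕ (c ℕ.* (c ℕ.+ 4))) s →
    ∀ θ → IsExp (- fromℕ c + s) θ →
    Empty (𝒜 θ))
theorem5 ℝ = Reals.alternating-𝒜-empty ℝ , Reals.sqrt-𝒜-empty ℝ
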